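{- Let $j,k\ge 4$ and consider the Game of Cycles on the $j$-$2$-$k$ graph. If $j+k$ is odd, Player 1 has a winning strategy; if $j+k$ is even, Player 2 has a winning strategy.
   Context: Game of Cycles: the gameboard is a simple connected graph drawn in the plane without crossings. Players 1 and 2 alternate turns, Player 1 first; on a turn a player must, if possible, direct one currently undirected edge, and it is illegal to create a sink (a vertex all of whose incident edges point into it) or a source (a vertex all of whose incident edges point out of it). A cycle cell is a cycle of the graph bounding a bounded face of the drawing; a player who directs an edge so that all edges of some cycle cell are directed consistently around it wins immediately. Otherwise the player who makes the last legal move wins. A $j$-$2$-$k$ graph consists of two vertices joined by three internally disjoint paths: an upper path with $j$ edges, a middle path with $2$ edges, and a lower path with $k$ edges, all other vertices having degree $2$; it is drawn with the middle path between the upper and lower paths, so its cycle cells are the $(j+2)$-cycle formed by the upper and middle paths and the $(k+2)$-cycle formed by the middle and lower paths. -}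

module Defs where

open import Data.Nat using (ℕ; zero; suc; _+_; _≡ᵇ_)
open import Data.Bool using (Bool; true; false; not; if_then_else_)
open import Data.Fin using (Fin; toℕ) renaming (zero to fz; suc to fs)
import Data.Fin.Properties as FinP
open import Data.Sum using (_⊎_; inj₁; inj₂)
open import Data.Sum.Properties using (≡-dec)
open import Data.Product using (_×_; _,_)
open import Data.List using (List; []; _∷_; _++_; map; allFin)
open import Data.List.Relation.Unary.All using (All)
open import Data.List.Relation.Unary.Any using (Any)
open import Relation.Nullary using (¬_; yes; no)
open import Relation.Binary.Definitions using (DecidableEquality)
open import Relation.Binary.PropositionalEquality using (_≡_)
open import Data.Nat using (_<_)

-- A game board: a plane graph given by its edges (each with a fixed
-- reference orientation tail → head), vertices the naturals < nV, and
-- its cycle cells (boundaries of bounded faces).  A cycle cell is a list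
-- of its edges, each tagged with whether the reference orientation of the
-- edge agrees (true) with one fixed traversal direction of the cycle.

record Board : Set₁ where
  field
    Edge   : Set
    _≟E_   : DecidableEquality Edge
    nV     : ℕ
    tail   : Edge → ℕ
    head   : Edge → ℕ
    cells  : List (List (Edge × Bool))

data Dir : Set where
  undir fwd bwd : Dir

orient : Bool → Dir
orient true  = fwd
orient false = bwd

module Game (G : Board) where
  open Board G

  State : Set
  State = Edge → Dir

  start : State
  start _ = undir

  update : State → Edge → Bool → State
  update s e o e' with e ≟E e'
  ... | yes _ = orient o
  ... | no  _ = s e'

  Incident : Edge → ℕ → Set
  Incident e v = (tail e ≡ v) ⊎ (head e ≡ v)

  PointsInto : State → Edge → ℕ → Set
  PointsInto s e v = (s e ≡ fwd × head e ≡ v) ⊎ (s e ≡ bwd × tail e ≡ v)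

  PointsOutOf : State → Edge → ℕ → Set
  PointsOutOf s e v = (s e ≡ fwd × tail e ≡ v) ⊎ (s e ≡ bwd × head e ≡ v)

  Sink : State → ℕ → Set
  Sink s v = ∀ e → Incident e v → PointsInto s e v

  Source : State → ℕ → Set
  Source s v = ∀ e → Incident e v → PointsOutOf s e v

  NoSinkSource : State → Set
  NoSinkSource s = ∀ v → v < nV → ¬ Sink s v × ¬ Source s v

  Legal : State → Edge → Bool → Set
  Legal s e o = s e ≡ undir × NoSinkSource (update s e o)

  Consistent : State → List (Edge × Bool) → Set
  Consistent s c = All (λ { (e , o) → s e ≡ orient o }) c
                 ⊎ All (λ { (e , o) → s e ≡ orient (not o) }) c

  CycleMade : State → Set
  CycleMade s = Any (Consistent s) cells

  -- Win s  : the player about to move from s has a winning strategy.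
  -- Lose s : the player about to move from s loses against best play
  --          (i.e. the other player has a winning strategy).
  -- A move completing a cycle cell wins at once; a player with no legal
  -- move loses (the last player to move wins).
  data Win  (s : State) : Set
  data Lose (s : State) : Set

  data Win s where
    win : (e : Edge) (o : Bool) → Legal s e o →
          CycleMade (update s e o) ⊎ Lose (update s e o) → Win s

  data Lose s where
    lose : ((e : Edge) (o : Bool) → Legal s e o →
             ¬ CycleMade (update s e o) × Win (update s e o)) → Lose s

-- The j-2-k graph.
-- Vertices: 0 = left endpoint a, 1 = right endpoint b, 2 = middle vertex,
-- upper interior vertex at position p (1 ≤ p ≤ j-1) is 2 + p,
-- lower interior vertex at position p (1 ≤ p ≤ k-1) is j + 1 + p.
-- So the vertex set is {0,…,j+k}.

upV : ℕ → ℕ → ℕ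
upV j zero    = 0
upV j (suc p) = if suc p ≡ᵇ j then 1 else 2 + suc p

lowV : ℕ → ℕ → ℕ → ℕ
lowV j k zero    = 0
lowV j k (suc p) = if suc p ≡ᵇ k then 1 else j + 1 + suc p

-- edges: upper path edges, two middle edges, lower path edges
JKEdge : ℕ → ℕ → Set
JKEdge j k = Fin j ⊎ (Fin 2 ⊎ Fin k)

jkTail : ∀ j k → JKEdge j k → ℕ
jkTail j k (inj₁ i)             = upV j (toℕ i)
jkTail j k (inj₂ (inj₁ fz))     = 0
jkTail j k (inj₂ (inj₁ (fs _))) = 2
jkTail j k (inj₂ (inj₂ i))      = lowV j k (toℕ i)

jkHead : ∀ j k → JKEdge j k → ℕ
jkHead j k (inj₁ i)             = upV j (suc (toℕ i))
jkHead j k (inj₂ (inj₁ fz))     = 2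
jkHead j k (inj₂ (inj₁ (fs _))) = 1
jkHead j k (inj₂ (inj₂ i))      = lowV j k (suc (toℕ i))

-- all reference orientations point from a (0) towards b (1).
-- upper cell traversed a →(upper path)→ b →(middle path backwards)→ a
upperCell : ∀ j k → List (JKEdge j k × Bool)
upperCell j k = map (λ i → (inj₁ i , true)) (allFin j)
             ++ ((inj₂ (inj₁ fz) , false) ∷ (inj₂ (inj₁ (fs fz)) , false) ∷ [])

-- lower cell traversed a →(middle path)→ b →(lower path backwards)→ a
lowerCell : ∀ j k → List (JKEdge j k × Bool)
lowerCell j k = ((inj₂ (inj₁ fz) , true) ∷ (inj₂ (inj₁ (fs fz)) , true) ∷ [])
             ++ map (λ i → (inj₂ (inj₂ i) , false)) (allFin k)

jk-board : ℕ → ℕ → Board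
jk-board j k = record
  { Edge  = JKEdge j k
  ; _≟E_  = ≡-dec FinP._≟_ (≡-dec FinP._≟_ FinP._≟_)
  ; nV    = j + k + 1
  ; tail  = jkTail j k
  ; head  = jkHead j k
  ; cells = upperCell j k ∷ lowerCell j k ∷ []
  }

{-# OPTIONS --safe #-}
module Submission where

-- Call "responder" the player who wins if the number of edges left undirected at the end is even.
-- The board has the symmetry that reverses each path; in reference orientations the responder answers
-- a move by the same direction on the mirror edge.  From a symmetric position the opponent completes
-- no cell with an edge whose mirror edge is open, so only the centres of odd paths can hurt.  If j + k
-- is odd, Player 1 opens with the one centre; if j and k are even there is none.  If both are odd, the
-- two centres answer each other, and the responder departs from mirroring only when an outer path is
-- about to lack nothing but its centre.  He then mostly uses the other centre as a waiting move: the
-- cell keeps two open edges, and whoever directs the first lets the other complete the cell.  If an end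
-- edge was played while the middle path is open, this can fail; then a suitable middle edge spoils both
-- cells, and parity decides: in a terminal position the undirected edges are the places where a path
-- changes direction, and the three edges at each end vertex, virtual directions included, contain
-- exactly one that opposes the other two.

open import Defs
open import Data.Nat using (ℕ; zero; suc; _+_; _∸_; _≤_; _<_; _%_; _≡ᵇ_; s≤s; z≤n; s≤s⁻¹; _<?_)
import Data.Nat.Properties as ℕ
open import Data.Bool using (Bool; true; false; not; if_then_else_; _xor_)
open import Data.Bool.Properties as Bool
  using (not-involutive; not-¬; ¬-not; not-distribˡ-xor; xor-same; xor-assoc; xor-identityʳ;
         xor-∧-commutativeRing)
open import Data.Fin using (Fin; toℕ; fromℕ<; opposite) renaming (zero to fz; suc to fs)
import Data.Fin.Properties as Fin
open import Data.List using ([]; _∷_; map; allFin)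
open import Data.List.Relation.Unary.All using ([]; _∷_; all?)
import Data.List.Relation.Unary.All.Properties as All
open import Data.List.Relation.Unary.Any using (here; there; any?)
open import Data.Sum as Sum using (_⊎_; inj₁; inj₂; [_,_]′)
open import Data.Product using (∃; _×_; _,_; proj₁; proj₂)
open import Data.Empty using (⊥; ⊥-elim)
open import Function using (_∘_; case_of_)
open import Relation.Nullary using (¬_; Dec; yes; no)
open import Relation.Nullary.Decidable using (map′; _⊎-dec_; _×-dec_; _→-dec_; ¬?; decidable-stable)
open import Relation.Binary.Definitions using (tri<; tri≈; tri>)
open import Relation.Binary.PropositionalEquality
  using (_≡_; _≢_; refl; sym; trans; cong; cong₂; subst; module ≡-Reasoning)
open import Algebra.Bundles using (CommutativeRing)
open import Algebra.Properties.CommutativeSemigroup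
  (CommutativeRing.+-commutativeSemigroup xor-∧-commutativeRing) using (interchange; x∙yz≈z∙yx)

-- The direction is copied and not reversed because a mirror pair may be adjacent, as the two middle
-- edges are: copying makes them consistent, reversing would create a sink or a source. Under this
-- symmetry a source at `a` corresponds to a sink at `b`, so legality at one end transfers to the
-- other as long as the end edges are symmetric. That is the obstacle to the waiting move. It leaves
-- one edge directed and its mirror edge open. If these lie at the ends and the middle path is open,
-- the opponent can direct the two other edges at the vertex of the open edge like the rest of that
-- path, and the mirror replies would create a sink or source at the opposite vertex. Hence the
-- condition `TwoLeft.ends`, and hence the separate treatment of end edges. In a dead position
-- symmetry is lost and no particular reply is prescribed: every legal move keeps the position dead,
-- and parity shows that the responder always has one. The bound 4 ensures that the neighbour of an
-- end edge of an outer path is neither the centre nor the other end edge of that path.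

orient-injective : ∀ {a b} → orient a ≡ orient b → a ≡ b
orient-injective {true}  {true}  _ = refl
orient-injective {false} {false} _ = refl

orient≢undir : ∀ {b} → orient b ≢ undir
orient≢undir {true}  ()
orient≢undir {false} ()

not-opposite : ∀ {z : Dir} {b} → z ≡ orient b → z ≢ orient (not b)
not-opposite p q = not-¬ refl (orient-injective (trans (sym p) q))

undirected-or-directed : (z : Dir) → z ≡ undir ⊎ ∃ λ b → z ≡ orient b
undirected-or-directed undir = inj₁ refl
undirected-or-directed fwd   = inj₂ (true , refl)
undirected-or-directed bwd   = inj₂ (false , refl)

-- Paths, ends and coordinates of edges

data Path : Set where
  upper middle lower : Path

_≟P_ : (X Y : Path) → Dec (X ≡ Y)
upper  ≟P upper  = yes refl
upper  ≟P middle = no λ ()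
upper  ≟P lower  = no λ ()
middle ≟P upper  = no λ ()
middle ≟P middle = yes refl
middle ≟P lower  = no λ ()
lower  ≟P upper  = no λ ()
lower  ≟P middle = no λ ()
lower  ≟P lower  = yes refl

data End : Set where
  left right : End

module Geometry (j k : ℕ) (4≤j : 4 ≤ j) (4≤k : 4 ≤ k) where
  open Game (jk-board j k) public
  open Board (jk-board j k) public using (Edge; _≟E_; nV; tail; head)

  path : Edge → Path
  path (inj₁ _)        = upper
  path (inj₂ (inj₁ _)) = middle
  path (inj₂ (inj₂ _)) = lower

  idx : Edge → ℕ
  idx (inj₁ i)        = toℕ i
  idx (inj₂ (inj₁ i)) = toℕ i
  idx (inj₂ (inj₂ i)) = toℕ i

  len : Path → ℕ
  len upper  = j
  len middle = 2
  len lower  = k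

  2≤len : ∀ X → 2 ≤ len X
  2≤len upper  = ℕ.≤-trans (s≤s (s≤s z≤n)) 4≤j
  2≤len middle = ℕ.≤-refl
  2≤len lower  = ℕ.≤-trans (s≤s (s≤s z≤n)) 4≤k

  0<len : ∀ X → 0 < len X
  0<len X = ℕ.≤-trans (s≤s z≤n) (2≤len X)

  idx<len : ∀ e → idx e < len (path e)
  idx<len (inj₁ i)        = Fin.toℕ<n i
  idx<len (inj₂ (inj₁ i)) = Fin.toℕ<n i
  idx<len (inj₂ (inj₂ i)) = Fin.toℕ<n i

  edge : ∀ X → Fin (len X) → Edge
  edge upper  i = inj₁ i
  edge middle i = inj₂ (inj₁ i)
  edge lower  i = inj₂ (inj₂ i)

  path-edge : ∀ X i → path (edge X i) ≡ X
  path-edge upper  i = refl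
  path-edge middle i = refl
  path-edge lower  i = refl

  idx-edge : ∀ X i → idx (edge X i) ≡ toℕ i
  idx-edge upper  i = refl
  idx-edge middle i = refl
  idx-edge lower  i = refl

  edge-unique : ∀ {e f} → path e ≡ path f → idx e ≡ idx f → e ≡ f
  edge-unique {inj₁ _}        {inj₁ _}        _ q = cong inj₁ (Fin.toℕ-injective q)
  edge-unique {inj₁ _}        {inj₂ (inj₁ _)} () _
  edge-unique {inj₁ _}        {inj₂ (inj₂ _)} () _
  edge-unique {inj₂ (inj₁ _)} {inj₂ (inj₁ _)} _ q = cong (inj₂ ∘ inj₁) (Fin.toℕ-injective q)
  edge-unique {inj₂ (inj₁ _)} {inj₂ (inj₂ _)} () _
  edge-unique {inj₂ (inj₁ _)} {inj₁ _}        () _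
  edge-unique {inj₂ (inj₂ _)} {inj₂ (inj₂ _)} _ q = cong (inj₂ ∘ inj₂) (Fin.toℕ-injective q)
  edge-unique {inj₂ (inj₂ _)} {inj₂ (inj₁ _)} () _
  edge-unique {inj₂ (inj₂ _)} {inj₁ _}        () _

  edge-at : ∀ X {i} → i < len X → ∃ λ e → path e ≡ X × idx e ≡ i
  edge-at X i<n = edge X (fromℕ< i<n) , path-edge X _ , trans (idx-edge X _) (Fin.toℕ-fromℕ< i<n)

  any-edge? : {Q : Edge → Set} → (∀ e → Dec (Q e)) → Dec (∃ Q)
  any-edge? Q? = map′
    (λ { (inj₁ (i , q)) → inj₁ i , q
       ; (inj₂ (inj₁ (i , q))) → inj₂ (inj₁ i) , q
       ; (inj₂ (inj₂ (i , q))) → inj₂ (inj₂ i) , q })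
    (λ { (inj₁ i , q) → inj₁ (i , q)
       ; (inj₂ (inj₁ i) , q) → inj₂ (inj₁ (i , q))
       ; (inj₂ (inj₂ i) , q) → inj₂ (inj₂ (i , q)) })
    (Fin.any? (λ i → Q? (inj₁ i))
      ⊎-dec (Fin.any? (λ i → Q? (inj₂ (inj₁ i))) ⊎-dec Fin.any? (λ i → Q? (inj₂ (inj₂ i)))))

  all-edges? : {Q : Edge → Set} → (∀ e → Dec (Q e)) → Dec (∀ e → Q e)
  all-edges? Q? = map′
    (λ none e → decidable-stable (Q? e) (λ ¬q → none (e , ¬q)))
    (λ all → λ { (e , ¬q) → ¬q (all e) })
    (¬? (any-edge? (λ e → ¬? (Q? e))))

  -- The mirror symmetry and the ends of paths

  mirror : Edge → Edge
  mirror (inj₁ i)        = inj₁ (opposite i)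
  mirror (inj₂ (inj₁ i)) = inj₂ (inj₁ (opposite i))
  mirror (inj₂ (inj₂ i)) = inj₂ (inj₂ (opposite i))

  path-mirror : ∀ e → path (mirror e) ≡ path e
  path-mirror (inj₁ _)        = refl
  path-mirror (inj₂ (inj₁ _)) = refl
  path-mirror (inj₂ (inj₂ _)) = refl

  mirror-involutive : ∀ e → mirror (mirror e) ≡ e
  mirror-involutive (inj₁ i)        = cong inj₁ (Fin.opposite-involutive i)
  mirror-involutive (inj₂ (inj₁ i)) = cong (inj₂ ∘ inj₁) (Fin.opposite-involutive i)
  mirror-involutive (inj₂ (inj₂ i)) = cong (inj₂ ∘ inj₂) (Fin.opposite-involutive i)

  idx-mirror : ∀ e → idx (mirror e) + suc (idx e) ≡ len (path e)
  idx-mirror (inj₁ i)        =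
    trans (cong (_+ suc (toℕ i)) (Fin.opposite-prop i)) (ℕ.m∸n+n≡m (Fin.toℕ<n i))
  idx-mirror (inj₂ (inj₁ i)) =
    trans (cong (_+ suc (toℕ i)) (Fin.opposite-prop i)) (ℕ.m∸n+n≡m (Fin.toℕ<n i))
  idx-mirror (inj₂ (inj₂ i)) =
    trans (cong (_+ suc (toℕ i)) (Fin.opposite-prop i)) (ℕ.m∸n+n≡m (Fin.toℕ<n i))

  mirror-injective : ∀ {e f} → mirror e ≡ mirror f → e ≡ f
  mirror-injective {e} {f} p =
    trans (sym (mirror-involutive e)) (trans (cong mirror p) (mirror-involutive f))

  mirror-flip : ∀ {e f} → mirror e ≡ f → e ≡ mirror f
  mirror-flip {e} p = trans (sym (mirror-involutive e)) (cong mirror p)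

  Next : Edge → Edge → Set
  Next e f = path e ≡ path f × suc (idx e) ≡ idx f

  AtEnd : End → Edge → Set
  AtEnd left  e = idx e ≡ 0
  AtEnd right e = suc (idx e) ≡ len (path e)

  flip : End → End
  flip left  = right
  flip right = left

  AtEnd? : ∀ t e → Dec (AtEnd t e)
  AtEnd? left  e = idx e ℕ.≟ 0
  AtEnd? right e = suc (idx e) ℕ.≟ len (path e)

  Next? : ∀ e f → Dec (Next e f)
  Next? e f = (path e ≟P path f) ×-dec (suc (idx e) ℕ.≟ idx f)

  mirror-AtEnd : ∀ t {e} → AtEnd t e → AtEnd (flip t) (mirror e)
  mirror-AtEnd left {e} p = begin
    suc (idx (mirror e))       ≡⟨ ℕ.+-comm 1 _ ⟩
    idx (mirror e) + 1         ≡⟨ cong (λ i → idx (mirror e) + suc i) p ⟨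
    idx (mirror e) + suc (idx e) ≡⟨ idx-mirror e ⟩
    len (path e)               ≡⟨ cong len (path-mirror e) ⟨
    len (path (mirror e))      ∎
    where open ≡-Reasoning
  mirror-AtEnd right {e} p =
    ℕ.+-cancelʳ-≡ (suc (idx e)) (idx (mirror e)) 0 (trans (idx-mirror e) (sym p))

  mirror-Next : ∀ {e f} → Next e f → Next (mirror f) (mirror e)
  mirror-Next {e} {f} (p , q) =
    trans (path-mirror f) (trans (sym p) (sym (path-mirror e))) ,
    ℕ.+-cancelʳ-≡ (suc (idx e)) (suc (idx (mirror f))) (idx (mirror e)) (begin
      suc (idx (mirror f)) + suc (idx e)   ≡⟨ ℕ.+-suc (idx (mirror f)) (suc (idx e)) ⟨
      idx (mirror f) + suc (suc (idx e))   ≡⟨ cong (λ i → idx (mirror f) + suc i) q ⟩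
      idx (mirror f) + suc (idx f)         ≡⟨ idx-mirror f ⟩
      len (path f)                         ≡⟨ cong len p ⟨
      len (path e)                         ≡⟨ idx-mirror e ⟨
      idx (mirror e) + suc (idx e)         ∎)
    where open ≡-Reasoning

  not-both-ends : ∀ t {e} → AtEnd t e → ¬ AtEnd (flip t) e
  not-both-ends left {e} p q =
    ℕ.<-irrefl (trans (cong suc (sym p)) q) (2≤len (path e))
  not-both-ends right {e} p q =
    ℕ.<-irrefl (trans (cong suc (sym q)) p) (2≤len (path e))

  -- Sinks and sources in terms of positions on paths

  Flow : State → Set
  Flow s = ∀ {e f} b → Next e f → s e ≡ orient b → s f ≢ orient (not b)

  Saturated : State → End → Bool → Set
  Saturated s t b = ∀ e → AtEnd t e → s e ≡ orient b

  -- All edges run from a to b, so a sink or source of degree 2 is a pair of opposed consecutive edges,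
  -- and one at a or b is a triple of equally directed edges.
  record Good (s : State) : Set where
    constructor good
    field
      flow        : Flow s
      unsaturated : ∀ t b → ¬ Saturated s t b
  open Good public

  -- The vertex numbers of the board made uniform in the path: edge `i` of a path runs from position
  -- `i` to position `i + 1`, and the positions 0 and `len X` are the shared vertices `a` and `b`.
  vertex : Path → ℕ → ℕ
  vertex upper  p             = upV j p
  vertex middle zero          = 0
  vertex middle (suc zero)    = 2
  vertex middle (suc (suc _)) = 1
  vertex lower  p             = lowV j k p

  tail-vertex : ∀ e → tail e ≡ vertex (path e) (idx e)
  tail-vertex (inj₁ _)                  = refl
  tail-vertex (inj₂ (inj₁ fz))          = refl
  tail-vertex (inj₂ (inj₁ (fs fz)))     = refl
  tail-vertex (inj₂ (inj₂ _))           = refl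

  head-vertex : ∀ e → head e ≡ vertex (path e) (suc (idx e))
  head-vertex (inj₁ _)                  = refl
  head-vertex (inj₂ (inj₁ fz))          = refl
  head-vertex (inj₂ (inj₁ (fs fz)))     = refl
  head-vertex (inj₂ (inj₂ _))           = refl

  -- The interior vertices of a path are numbered consecutively, so one offset per path describes
  -- them.
  base : Path → ℕ
  base upper  = 2
  base middle = 1
  base lower  = j + 1

  private
    if-≡ᵇ-yes : ∀ {A : Set} {x y : A} m n → m ≡ n → (if m ≡ᵇ n then x else y) ≡ x
    if-≡ᵇ-yes m n p with m ≡ᵇ n | ℕ.≡⇒≡ᵇ m n p
    ... | true | _ = refl

    if-≡ᵇ-no : ∀ {A : Set} {x y : A} m n → m ≢ n → (if m ≡ᵇ n then x else y) ≡ y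
    if-≡ᵇ-no m n p with m ≡ᵇ n | ℕ.≡ᵇ⇒≡ m n
    ... | true  | f = ⊥-elim (p (f _))
    ... | false | _ = refl

  Interior : Path → ℕ → Set
  Interior X p = 0 < p × p < len X

  vertex-start : ∀ X → vertex X 0 ≡ 0
  vertex-start upper  = refl
  vertex-start middle = refl
  vertex-start lower  = refl

  vertex-interior : ∀ X {p} → Interior X p → vertex X p ≡ base X + p
  vertex-interior upper  {suc p} (_ , p<n) = if-≡ᵇ-no (suc p) j (ℕ.<⇒≢ p<n)
  vertex-interior middle {suc zero} _ = refl
  vertex-interior middle {suc (suc p)} (_ , s≤s (s≤s ()))
  vertex-interior lower  {suc p} (_ , p<n) = if-≡ᵇ-no (suc p) k (ℕ.<⇒≢ p<n)

  private
    up-finish : ∀ n → 0 < n → upV n n ≡ 1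
    up-finish (suc n) _ = if-≡ᵇ-yes (suc n) (suc n) refl

    low-finish : ∀ m n → 0 < n → lowV m n n ≡ 1
    low-finish m (suc n) _ = if-≡ᵇ-yes (suc n) (suc n) refl

  vertex-finish : ∀ X → vertex X (len X) ≡ 1
  vertex-finish upper  = up-finish j (0<len upper)
  vertex-finish middle = refl
  vertex-finish lower  = low-finish j k (0<len lower)

  data Position (X : Path) : ℕ → Set where
    start-vertex  : Position X 0
    inner-vertex  : ∀ {p} → Interior X p → Position X p
    finish-vertex : Position X (len X)

  position : ∀ X {p} → p ≤ len X → Position X p
  position X {zero}  _ = start-vertex
  position X {suc p} p≤n with ℕ.m≤n⇒m<n∨m≡n p≤n
  ... | inj₁ p<n  = inner-vertex (s≤s z≤n , p<n)
  ... | inj₂ p≡n  = subst (Position X) (sym p≡n) finish-vertex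

  2≤interior : ∀ X {p} → Interior X p → 2 ≤ vertex X p
  2≤interior X {p} i = subst (2 ≤_) (sym (vertex-interior X i)) (bound X i)
    where
    bound : ∀ X {p} → Interior X p → 2 ≤ base X + p
    bound upper  _         = s≤s (s≤s z≤n)
    bound middle (0<p , _) = s≤s 0<p
    bound lower  {p} _     = ℕ.≤-trans (ℕ.≤-trans (2≤len upper) (ℕ.m≤m+n j 1)) (ℕ.m≤m+n (j + 1) p)

  -- The offsets give disjoint ranges: 2 for the middle path, 3 to `j + 1` for the upper one,
  -- `j + 2` to `j + k` for the lower one.
  interior-injective : ∀ X Y {p q} → Interior X p → Interior Y q →
                       vertex X p ≡ vertex Y q → X ≡ Y × p ≡ q
  interior-injective X Y {p} {q} i i′ eq =
    go X Y i i′ (trans (sym (vertex-interior X i)) (trans eq (vertex-interior Y i′)))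
    where
    middle≢upper : ∀ {p q} → q < 2 → 1 + q ≢ 2 + suc p
    middle≢upper (s≤s (s≤s ())) refl

    upper≢lower : ∀ {p q} → p < j → 2 + p ≢ j + 1 + suc q
    upper≢lower {p} {q} p<j = ℕ.<⇒≢ (begin-strict
      2 + p           ≤⟨ s≤s p<j ⟩
      1 + j           ≡⟨ ℕ.+-comm 1 j ⟩
      j + 1           <⟨ ℕ.m<m+n (j + 1) (s≤s z≤n) ⟩
      j + 1 + suc q   ∎)
      where open ℕ.≤-Reasoning

    middle≢lower : ∀ {p q} → p < 2 → 1 + p ≢ j + 1 + suc q
    middle≢lower {p} {q} p<2 = ℕ.<⇒≢ (begin-strict
      1 + p          ≤⟨ p<2 ⟩
      2              ≤⟨ 2≤len upper ⟩
      j              ≤⟨ ℕ.m≤m+n j 1 ⟩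
      j + 1          <⟨ ℕ.m<m+n (j + 1) (s≤s z≤n) ⟩
      j + 1 + suc q  ∎)
      where open ℕ.≤-Reasoning

    go : ∀ X Y {p q} → Interior X p → Interior Y q → base X + p ≡ base Y + q → X ≡ Y × p ≡ q
    go upper  upper  _ _ eq = refl , ℕ.+-cancelˡ-≡ 2 _ _ eq
    go upper  middle {suc p} _ (_ , q<2) eq = ⊥-elim (middle≢upper q<2 (sym eq))
    go upper  lower  {q = suc q} (_ , p<j) _ eq = ⊥-elim (upper≢lower p<j eq)
    go middle upper  {q = suc q} (_ , p<2) _ eq = ⊥-elim (middle≢upper p<2 eq)
    go middle middle _ _ eq = refl , ℕ.+-cancelˡ-≡ 1 _ _ eq
    go middle lower  {q = suc q} (_ , p<2) _ eq = ⊥-elim (middle≢lower p<2 eq)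
    go lower  upper  {suc p} _ (_ , q<j) eq = ⊥-elim (upper≢lower q<j (sym eq))
    go lower  middle {suc p} _ (_ , q<2) eq = ⊥-elim (middle≢lower q<2 (sym eq))
    go lower  lower  _ _ eq = refl , ℕ.+-cancelˡ-≡ (j + 1) _ _ eq

  -- Interior numbers are at least 2, while `a` and `b` are 0 and 1, so one position may be
  -- arbitrary. Two arbitrary positions would not do, because the three paths share their endpoints.
  vertex-injective : ∀ X Y {p q} → p ≤ len X → Interior Y q →
                     vertex X p ≡ vertex Y q → X ≡ Y × p ≡ q
  vertex-injective X Y p≤n i eq with position X p≤n
  ... | start-vertex   = ⊥-elim (ℕ.<⇒≱ (s≤s z≤n)
          (subst (2 ≤_) (trans (sym eq) (vertex-start X)) (2≤interior Y i)))
  ... | inner-vertex i′ = interior-injective X Y i′ i eq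
  ... | finish-vertex  = ⊥-elim (ℕ.<⇒≱ (s≤s (s≤s z≤n))
          (subst (2 ≤_) (trans (sym eq) (vertex-finish X)) (2≤interior Y i)))

  vertex≡0 : ∀ X {p} → p ≤ len X → vertex X p ≡ 0 → p ≡ 0
  vertex≡0 X p≤n eq with position X p≤n
  ... | start-vertex   = refl
  ... | inner-vertex i = ⊥-elim (ℕ.<⇒≱ (s≤s z≤n) (subst (2 ≤_) eq (2≤interior X i)))
  ... | finish-vertex  = case trans (sym (vertex-finish X)) eq of λ ()

  vertex≡1 : ∀ X {p} → p ≤ len X → vertex X p ≡ 1 → p ≡ len X
  vertex≡1 X p≤n eq with position X p≤n
  ... | start-vertex   = case trans (sym (vertex-start X)) eq of λ ()
  ... | inner-vertex i = ⊥-elim (ℕ.<⇒≱ (s≤s (s≤s z≤n)) (subst (2 ≤_) eq (2≤interior X i)))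
  ... | finish-vertex  = refl

  interior<nV : ∀ X {p} → Interior X p → vertex X p < nV
  interior<nV X {p} i = subst (_< nV) (sym (vertex-interior X i)) (go X i)
    where
    open ℕ.≤-Reasoning
    go : ∀ X {p} → Interior X p → base X + p < nV
    go upper {p} (_ , p<j) = begin-strict
      2 + p       ≤⟨ s≤s p<j ⟩
      1 + j       <⟨ s≤s (ℕ.m<m+n j (0<len lower)) ⟩
      1 + (j + k) ≡⟨ ℕ.+-comm 1 (j + k) ⟩
      j + k + 1   ∎
    go middle {p} (_ , p<2) = begin-strict
      1 + p       ≤⟨ p<2 ⟩
      2           ≤⟨ 2≤len upper ⟩
      j           <⟨ ℕ.m<m+n j (0<len lower) ⟩
      j + k       ≤⟨ ℕ.m≤m+n (j + k) 1 ⟩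
      j + k + 1   ∎
    go lower {p} (_ , p<k) = begin-strict
      j + 1 + p   <⟨ ℕ.+-monoʳ-< (j + 1) p<k ⟩
      j + 1 + k   ≡⟨ ℕ.+-assoc j 1 k ⟩
      j + (1 + k) ≡⟨ cong (j +_) (ℕ.+-comm 1 k) ⟩
      j + (k + 1) ≡⟨ ℕ.+-assoc j k 1 ⟨
      j + k + 1   ∎

  data Vertex : ℕ → Set where
    a-vertex : Vertex 0
    b-vertex : Vertex 1
    on-path  : ∀ X {p} → Interior X p → Vertex (vertex X p)

  classify : ∀ v → v < nV → Vertex v
  classify zero                _ = a-vertex
  classify (suc zero)          _ = b-vertex
  classify (suc (suc zero))    _ = on-path middle {1} (s≤s z≤n , s≤s (s≤s z≤n))
  classify (suc (suc (suc m))) v<nV with suc m <? j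
  ... | yes p<j = subst Vertex (vertex-interior upper i) (on-path upper i)
    where
    i : Interior upper (suc m)
    i = s≤s z≤n , p<j
  ... | no  p≮j = subst Vertex (trans (vertex-interior lower i) v≡) (on-path lower i)
    where
    open ≡-Reasoning
    j≤ : j ≤ suc m
    j≤ = ℕ.≮⇒≥ p≮j
    -- The vertex number is `m + 3`, and the offset of the lower path is `j + 1`.
    p : ℕ
    p = suc (suc m ∸ j)
    v≡ : j + 1 + p ≡ suc (suc (suc m))
    v≡ = begin
      j + 1 + suc (suc m ∸ j)     ≡⟨ cong (_+ p) (ℕ.+-comm j 1) ⟩
      suc (j + suc (suc m ∸ j))   ≡⟨ cong suc (ℕ.+-suc j (suc m ∸ j)) ⟩
      suc (suc (j + (suc m ∸ j))) ≡⟨ cong (suc ∘ suc) (ℕ.m+[n∸m]≡n j≤) ⟩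
      suc (suc (suc m))           ∎
    nV≡ : nV ≡ j + 1 + k
    nV≡ = begin
      j + k + 1   ≡⟨ ℕ.+-assoc j k 1 ⟩
      j + (k + 1) ≡⟨ cong (j +_) (ℕ.+-comm k 1) ⟩
      j + (1 + k) ≡⟨ ℕ.+-assoc j 1 k ⟨
      j + 1 + k   ∎
    i : Interior lower p
    i = s≤s z≤n , ℕ.+-cancelˡ-< (j + 1) p k
          (subst (j + 1 + p <_) nV≡ (subst (_< nV) (sym v≡) v<nV))

  private
    tail-at : ∀ {Y q} e → Interior Y q → tail e ≡ vertex Y q → path e ≡ Y × idx e ≡ q
    tail-at e i p = vertex-injective (path e) _ (ℕ.<⇒≤ (idx<len e)) i (trans (sym (tail-vertex e)) p)

    head-at : ∀ {Y q} e → Interior Y q → head e ≡ vertex Y q → path e ≡ Y × suc (idx e) ≡ q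
    head-at e i p = vertex-injective (path e) _ (idx<len e) i (trans (sym (head-vertex e)) p)

    tail≡0⇒ : ∀ e → tail e ≡ 0 → idx e ≡ 0
    tail≡0⇒ e p = vertex≡0 (path e) (ℕ.<⇒≤ (idx<len e)) (trans (sym (tail-vertex e)) p)

    head≢0 : ∀ e → head e ≢ 0
    head≢0 e p with vertex≡0 (path e) (idx<len e) (trans (sym (head-vertex e)) p)
    ... | ()

    head≡1⇒ : ∀ e → head e ≡ 1 → suc (idx e) ≡ len (path e)
    head≡1⇒ e p = vertex≡1 (path e) (idx<len e) (trans (sym (head-vertex e)) p)

    tail≢1 : ∀ e → tail e ≢ 1
    tail≢1 e p = ℕ.<-irrefl
      (vertex≡1 (path e) (ℕ.<⇒≤ (idx<len e)) (trans (sym (tail-vertex e)) p)) (idx<len e)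

    ⇒tail≡0 : ∀ e → idx e ≡ 0 → tail e ≡ 0
    ⇒tail≡0 e p = trans (tail-vertex e) (trans (cong (vertex (path e)) p) (vertex-start (path e)))

    ⇒head≡1 : ∀ e → suc (idx e) ≡ len (path e) → head e ≡ 1
    ⇒head≡1 e p = trans (head-vertex e) (trans (cong (vertex (path e)) p) (vertex-finish (path e)))

    head≡tail : ∀ {e f} → Next e f → head e ≡ tail f
    head≡tail {e} {f} (p , q) = trans (head-vertex e) (trans (cong₂ vertex p q) (sym (tail-vertex f)))

    next-interior : ∀ {e f} → Next e f → Interior (path f) (idx f)
    next-interior {e} {f} (p , q) = subst (0 <_) q (s≤s z≤n) , idx<len f

  Good⇒NoSinkSource : ∀ {s} → Good s → NoSinkSource s
  Good⇒NoSinkSource {s} g v v<nV with classify v v<nV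
  ... | a-vertex =
      (λ sink → unsaturated g left false λ e p → case sink e (inj₁ (⇒tail≡0 e p)) of λ
        { (inj₁ (_ , q)) → ⊥-elim (head≢0 e q) ; (inj₂ (q , _)) → q }) ,
      (λ source → unsaturated g left true λ e p → case source e (inj₁ (⇒tail≡0 e p)) of λ
        { (inj₁ (q , _)) → q ; (inj₂ (_ , q)) → ⊥-elim (head≢0 e q) })
  ... | b-vertex =
      (λ sink → unsaturated g right true λ e p → case sink e (inj₂ (⇒head≡1 e p)) of λ
        { (inj₁ (q , _)) → q ; (inj₂ (_ , q)) → ⊥-elim (tail≢1 e q) }) ,
      (λ source → unsaturated g right false λ e p → case source e (inj₂ (⇒head≡1 e p)) of λ
        { (inj₁ (_ , q)) → ⊥-elim (tail≢1 e q) ; (inj₂ (q , _)) → q })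
  ... | on-path X {suc p} i =
      (λ sink → flow g true nx
        (case sink e (inj₂ he) of λ { (inj₁ (q , _)) → q ; (inj₂ (_ , q)) → ⊥-elim (te≢ q) })
        (case sink f (inj₁ tf) of λ { (inj₁ (_ , q)) → ⊥-elim (hf≢ q) ; (inj₂ (q , _)) → q })) ,
      (λ source → flow g false nx
        (case source e (inj₂ he) of λ { (inj₁ (_ , q)) → ⊥-elim (te≢ q) ; (inj₂ (q , _)) → q })
        (case source f (inj₁ tf) of λ { (inj₁ (q , _)) → q ; (inj₂ (_ , q)) → ⊥-elim (hf≢ q) }))
    where
    E₀ = edge-at X {p} (ℕ.<-trans (ℕ.n<1+n p) (proj₂ i))
    E₁ = edge-at X {suc p} (proj₂ i)
    e = proj₁ E₀
    f = proj₁ E₁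
    nx : Next e f
    nx = trans (proj₁ (proj₂ E₀)) (sym (proj₁ (proj₂ E₁))) ,
         trans (cong suc (proj₂ (proj₂ E₀))) (sym (proj₂ (proj₂ E₁)))
    tf : tail f ≡ vertex X (suc p)
    tf = trans (tail-vertex f) (cong₂ vertex (proj₁ (proj₂ E₁)) (proj₂ (proj₂ E₁)))
    he : head e ≡ vertex X (suc p)
    he = trans (head≡tail nx) tf
    te≢ : tail e ≢ vertex X (suc p)
    te≢ q = ℕ.1+n≢n (sym (trans (sym (proj₂ (proj₂ E₀))) (proj₂ (tail-at e i q))))
    hf≢ : head f ≢ vertex X (suc p)
    hf≢ q = ℕ.1+n≢n (trans (cong suc (sym (proj₂ (proj₂ E₁)))) (proj₂ (head-at f i q)))

  NoSinkSource⇒Good : ∀ {s} → NoSinkSource s → Good s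
  NoSinkSource⇒Good {s} ok = good flow′ unsat
    where
    0<nV : 0 < nV
    0<nV = ℕ.≤-trans (s≤s z≤n) (ℕ.m≤n+m 1 (j + k))

    1<nV : 1 < nV
    1<nV = ℕ.≤-trans (2≤len upper) (ℕ.≤-trans (ℕ.m≤m+n j k) (ℕ.m≤m+n (j + k) 1))

    at-a : ∀ e → Incident e 0 → idx e ≡ 0
    at-a e (inj₁ p) = tail≡0⇒ e p
    at-a e (inj₂ p) = ⊥-elim (head≢0 e p)

    at-b : ∀ e → Incident e 1 → suc (idx e) ≡ len (path e)
    at-b e (inj₁ p) = ⊥-elim (tail≢1 e p)
    at-b e (inj₂ p) = head≡1⇒ e p

    unsat : ∀ t b → ¬ Saturated s t b
    unsat left true sat = proj₂ (ok 0 0<nV) λ e i →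
      inj₁ (sat e (at-a e i) , ⇒tail≡0 e (at-a e i))
    unsat left false sat = proj₁ (ok 0 0<nV) λ e i →
      inj₂ (sat e (at-a e i) , ⇒tail≡0 e (at-a e i))
    unsat right true sat = proj₁ (ok 1 1<nV) λ e i →
      inj₁ (sat e (at-b e i) , ⇒head≡1 e (at-b e i))
    unsat right false sat = proj₂ (ok 1 1<nV) λ e i →
      inj₂ (sat e (at-b e i) , ⇒head≡1 e (at-b e i))

    -- Degree 2: no third edge meets the vertex between two consecutive edges, so two opposed
    -- directions there already make a sink or a source.
    only : ∀ {e f g} → Next e f → Incident g (tail f) → g ≡ e ⊎ g ≡ f
    only {e} {f} {g} nx (inj₁ p) with tail-at g (next-interior nx) (trans p (tail-vertex f))
    ... | q , r = inj₂ (edge-unique q r)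
    only {e} {f} {g} nx (inj₂ p) with head-at g (next-interior nx) (trans p (tail-vertex f))
    ... | q , r = inj₁ (edge-unique (trans q (sym (proj₁ nx)))
                                    (ℕ.suc-injective (trans r (sym (proj₂ nx)))))

    flow′ : Flow s
    flow′ {e} {f} b nx p q = clash b p q
      where
      ok′ = ok (tail f) (subst (_< nV) (sym (tail-vertex f)) (interior<nV (path f) (next-interior nx)))
      clash : ∀ b → s e ≡ orient b → s f ≡ orient (not b) → ⊥
      clash true p q = proj₁ ok′ λ g i → case only {e} {f} {g} nx i of λ
        { (inj₁ refl) → inj₁ (p , head≡tail nx) ; (inj₂ refl) → inj₂ (q , refl) }
      clash false p q = proj₂ ok′ λ g i → case only {e} {f} {g} nx i of λ
        { (inj₁ refl) → inj₂ (p , head≡tail nx) ; (inj₂ refl) → inj₁ (q , refl) }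

_≟D_ : (x y : Dir) → Dec (x ≡ y)
undir ≟D undir = yes refl
undir ≟D fwd   = no λ ()
undir ≟D bwd   = no λ ()
fwd   ≟D undir = no λ ()
fwd   ≟D fwd   = yes refl
fwd   ≟D bwd   = no λ ()
bwd   ≟D undir = no λ ()
bwd   ≟D fwd   = no λ ()
bwd   ≟D bwd   = yes refl

-- Parities and numbers of undirected edges

odd : ℕ → Bool
odd zero    = false
odd (suc n) = not (odd n)

odd-+ : ∀ m n → odd (m + n) ≡ odd m xor odd n
odd-+ zero    n = refl
odd-+ (suc m) n = trans (cong not (odd-+ m n)) (not-distribˡ-xor (odd m) (odd n))

undirected : Dir → ℕ
undirected undir = 1
undirected fwd   = 0
undirected bwd   = 0

undirected-orient : ∀ b → undirected (orient b) ≡ 0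
undirected-orient true  = refl
undirected-orient false = refl

#undirected : ∀ n → (Fin n → Dir) → ℕ
#undirected zero    f = 0
#undirected (suc n) f = undirected (f fz) + #undirected n (f ∘ fs)

#undirected-cong : ∀ n {f g : Fin n → Dir} → (∀ i → f i ≡ g i) → #undirected n f ≡ #undirected n g
#undirected-cong zero    eq = refl
#undirected-cong (suc n) eq = cong₂ _+_ (cong undirected (eq fz)) (#undirected-cong n (eq ∘ fs))

#undirected-empty : ∀ n → #undirected n (λ _ → undir) ≡ n
#undirected-empty zero    = refl
#undirected-empty (suc n) = cong suc (#undirected-empty n)

#undirected-fill : ∀ n {f g : Fin n → Dir} i {b} → f i ≡ undir → g i ≡ orient b →
                   (∀ i′ → i′ ≢ i → g i′ ≡ f i′) → #undirected n f ≡ suc (#undirected n g)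
#undirected-fill (suc n) {f} {g} fz {b} fi gi eq
  rewrite fi | gi | undirected-orient b = cong suc (#undirected-cong n λ i → sym (eq (fs i) λ ()))
#undirected-fill (suc n) {f} {g} (fs i) fi gi eq
  rewrite eq fz (λ ()) = trans
    (cong (undirected (f fz) +_) (#undirected-fill n i fi gi (λ i′ ne → eq (fs i′) (ne ∘ Fin.suc-injective))))
    (ℕ.+-suc (undirected (f fz)) _)

-- Moves, cells, and the passage from an invariant to a winning strategy

module Driver (j k : ℕ) (4≤j : 4 ≤ j) (4≤k : 4 ≤ k) where
  open Geometry j k 4≤j 4≤k public

  update-same : ∀ s e o → update s e o e ≡ orient o
  update-same s e o with e ≟E e
  ... | yes _ = refl
  ... | no ne = ⊥-elim (ne refl)

  update-other : ∀ s e o {f} → f ≢ e → update s e o f ≡ s f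
  update-other s e o {f} ne with e ≟E f
  ... | yes eq = ⊥-elim (ne (sym eq))
  ... | no _   = refl

  update-directed : ∀ s {e} o {f b} → s e ≡ undir → s f ≡ orient b → update s e o f ≡ orient b
  update-directed s {e} o {f} u p with e ≟E f
  ... | yes refl = ⊥-elim (orient≢undir (trans (sym p) u))
  ... | no _     = p

  update-undirected : ∀ s {e} o {f} → update s e o f ≡ undir → f ≢ e × s f ≡ undir
  update-undirected s {e} o {f} p with e ≟E f
  ... | yes refl = ⊥-elim (orient≢undir p)
  ... | no ne    = ne ∘ sym , p

  undirected-≢ : ∀ {s : State} {e f b} → s e ≡ undir → s f ≡ orient b → e ≢ f
  undirected-≢ u p refl = orient≢undir (trans (sym p) u)

  Along : State → Path → Bool → Set
  Along s X b = ∀ e → path e ≡ X → s e ≡ orient b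

  -- A cell runs out along an outer path and back along the middle path, and all reference
  -- orientations point from `a` to `b`. So both cells, traversed in either sense, have this one
  -- form.
  Cyclic : State → Path → Bool → Set
  Cyclic s X b = Along s X b × Along s middle (not b)

  NoCycle : State → Set
  NoCycle s = ∀ X b → X ≢ middle → ¬ Cyclic s X b

  Cyclic⇒CycleMade : ∀ {s} X b → X ≢ middle → Cyclic s X b → CycleMade s
  Cyclic⇒CycleMade middle _ ne _ = ⊥-elim (ne refl)
  Cyclic⇒CycleMade upper true _ (p , m) = here (inj₁ (All.++⁺
    (All.map⁺ (All.tabulate⁺ λ i → p (inj₁ i) refl)) (m _ refl ∷ m _ refl ∷ [])))
  Cyclic⇒CycleMade upper false _ (p , m) = here (inj₂ (All.++⁺
    (All.map⁺ (All.tabulate⁺ λ i → p (inj₁ i) refl)) (m _ refl ∷ m _ refl ∷ [])))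
  Cyclic⇒CycleMade lower true _ (p , m) = there (here (inj₂
    (m _ refl ∷ m _ refl ∷ All.map⁺ (All.tabulate⁺ λ i → p (inj₂ (inj₂ i)) refl))))
  Cyclic⇒CycleMade lower false _ (p , m) = there (here (inj₁
    (m _ refl ∷ m _ refl ∷ All.map⁺ (All.tabulate⁺ λ i → p (inj₂ (inj₂ i)) refl))))

  private
    along-upper : ∀ {s b} → (∀ i → s (inj₁ i) ≡ orient b) → Along s upper b
    along-upper f (inj₁ i) refl = f i
    along-upper f (inj₂ (inj₁ _)) ()
    along-upper f (inj₂ (inj₂ _)) ()

    along-lower : ∀ {s b} → (∀ i → s (inj₂ (inj₂ i)) ≡ orient b) → Along s lower b
    along-lower f (inj₁ i) ()
    along-lower f (inj₂ (inj₁ _)) ()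
    along-lower f (inj₂ (inj₂ i)) refl = f i

    along-middle : ∀ {s b} → s (inj₂ (inj₁ fz)) ≡ orient b → s (inj₂ (inj₁ (fs fz))) ≡ orient b →
                   Along s middle b
    along-middle p q (inj₁ i) ()
    along-middle p q (inj₂ (inj₁ fz)) refl = p
    along-middle p q (inj₂ (inj₁ (fs fz))) refl = q
    along-middle p q (inj₂ (inj₂ i)) ()

  CycleMade⇒Cyclic : ∀ {s} → CycleMade s → ∃ λ X → ∃ λ b → X ≢ middle × Cyclic s X b
  CycleMade⇒Cyclic {s} (here (inj₁ c)) with All.++⁻ (map _ (allFin j)) c
  ... | p , m₀ ∷ m₁ ∷ [] = upper , true , (λ ()) ,
    along-upper (All.tabulate⁻ (All.map⁻ p)) , along-middle m₀ m₁
  CycleMade⇒Cyclic {s} (here (inj₂ c)) with All.++⁻ (map _ (allFin j)) c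
  ... | p , m₀ ∷ m₁ ∷ [] = upper , false , (λ ()) ,
    along-upper (All.tabulate⁻ (All.map⁻ p)) , along-middle m₀ m₁
  CycleMade⇒Cyclic {s} (there (here (inj₁ (m₀ ∷ m₁ ∷ p)))) = lower , false , (λ ()) ,
    along-lower (All.tabulate⁻ (All.map⁻ p)) , along-middle m₀ m₁
  CycleMade⇒Cyclic {s} (there (here (inj₂ (m₀ ∷ m₁ ∷ p)))) = lower , true , (λ ()) ,
    along-lower (All.tabulate⁻ (All.map⁻ p)) , along-middle m₀ m₁

  CycleMade? : ∀ s → Dec (CycleMade s)
  CycleMade? s = any? (λ c →
    all? (λ { (e , o) → s e ≟D orient o }) c ⊎-dec all? (λ { (e , o) → s e ≟D orient (not o) }) c) _

  count : State → ℕ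
  count s = #undirected j (s ∘ edge upper) + #undirected 2 (s ∘ edge middle) + #undirected k (s ∘ edge lower)

  count-start : count start ≡ j + 2 + k
  count-start = cong₂ (λ m n → m + 2 + n) (#undirected-empty j) (#undirected-empty k)

  private
    filled : ∀ s X i o → s (edge X i) ≡ undir →
             #undirected (len X) (s ∘ edge X) ≡ suc (#undirected (len X) (update s (edge X i) o ∘ edge X))
    filled s X i o u = #undirected-fill (len X) i u (update-same s (edge X i) o)
      (λ i′ ne → update-other s (edge X i) o (ne ∘ edge-injective X))
      where
      edge-injective : ∀ X {i i′} → edge X i ≡ edge X i′ → i ≡ i′
      edge-injective upper  refl = refl
      edge-injective middle refl = refl
      edge-injective lower  refl = refl

    unchanged : ∀ s e o Y → path e ≢ Y →
                #undirected (len Y) (s ∘ edge Y) ≡ #undirected (len Y) (update s e o ∘ edge Y)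
    unchanged s e o Y ne = #undirected-cong (len Y) λ i →
      sym (update-other s e o λ eq → ne (trans (cong path (sym eq)) (path-edge Y i)))

  count-update : ∀ s e o → s e ≡ undir → count s ≡ suc (count (update s e o))
  count-update s e@(inj₁ i) o u = cong₂ _+_
    (cong₂ _+_ (filled s upper i o u) (unchanged s e o middle λ ())) (unchanged s e o lower λ ())
  count-update s e@(inj₂ (inj₁ i)) o u = cong₂ _+_
    (trans (cong₂ _+_ (unchanged s e o upper λ ()) (filled s middle i o u)) (ℕ.+-suc _ _))
    (unchanged s e o lower λ ())
  count-update s e@(inj₂ (inj₂ i)) o u = trans
    (cong₂ _+_ (cong₂ _+_ (unchanged s e o upper λ ()) (unchanged s e o middle λ ()))
      (filled s lower i o u))
    (ℕ.+-suc _ _)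

  -- No condition on cells appears, because a reply that completes one wins at once. The invariant
  -- may therefore hold in positions with a completed cell.
  record Reply (Inv : State → Set) (s : State) : Set where
    constructor reply
    field
      r-edge  : Edge
      r-dir   : Bool
      r-free  : s r-edge ≡ undir
      r-good  : Good (update s r-edge r-dir)
      r-inv   : Inv (update s r-edge r-dir)

  -- `NoCycle s` may be assumed since play ends with a completed cell. The odd count after the
  -- opponent's move is what guarantees a reply in dead positions.
  Responsive : (State → Set) → Set
  Responsive Inv = ∀ {s} → Inv s → Good s → NoCycle s → ∀ e o → s e ≡ undir →
    Good (update s e o) → odd (count (update s e o)) ≡ true →
    NoCycle (update s e o) × Reply Inv (update s e o)

  -- Induction on a bound for the number of undirected edges, which drops by two per round. As a
  -- reply always exists, the responder never runs out of moves. Deciding `CycleMade` after the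
  -- reply separates an immediate win from the continuation.
  responsive⇒Lose : ∀ {Inv} → Responsive Inv → ∀ n {s} → count s < n →
    Inv s → Good s → NoCycle s → odd (count s) ≡ false → Lose s
  responsive⇒Lose {Inv} respond (suc n) {s} (s≤s c<) inv g nc ev = lose λ e o (u , ok) →
    let s₁ = update s e o
        g₁ = NoSinkSource⇒Good ok
        c₁ : count s ≡ suc (count s₁)
        c₁ = count-update s e o u
        odd₁ = trans (sym (not-involutive _)) (cong not (trans (cong odd (sym c₁)) ev))
        nc₁ , r = respond inv g nc e o u g₁ odd₁
    in (λ cm → case CycleMade⇒Cyclic cm of λ { (X , b , ne , c) → nc₁ X b ne c })
     , answer (subst (_≤ n) c₁ c<) odd₁ r
    where
    answer : ∀ {s₁} → suc (count s₁) ≤ n → odd (count s₁) ≡ true → Reply Inv s₁ → Win s₁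
    answer {s₁} c< od (reply e o u g₂ inv₂) = win e o (u , Good⇒NoSinkSource g₂) outcome
      where
      c₂ = count-update s₁ e o u
      outcome : CycleMade (update s₁ e o) ⊎ Lose (update s₁ e o)
      outcome with CycleMade? (update s₁ e o)
      ... | yes cm = inj₁ cm
      ... | no ncm = inj₂ (responsive⇒Lose respond n
              (ℕ.≤-trans (ℕ.≤-reflexive (sym c₂)) (ℕ.≤-trans (ℕ.n≤1+n _) c<)) inv₂ g₂
              (λ X b ne c → ncm (Cyclic⇒CycleMade X b ne c))
              (trans (sym (not-involutive _)) (cong not (trans (cong odd (sym c₂)) od))))

-- The two outer paths

data Sides : Path → Path → Set where
  upper-lower : Sides upper lower
  lower-upper : Sides lower upper

swap-sides : ∀ {P Q} → Sides P Q → Sides Q P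
swap-sides upper-lower = lower-upper
swap-sides lower-upper = upper-lower

side≢middle : ∀ {P Q} → Sides P Q → P ≢ middle
side≢middle upper-lower ()
side≢middle lower-upper ()

sides-differ : ∀ {P Q} → Sides P Q → P ≢ Q
sides-differ upper-lower ()
sides-differ lower-upper ()

opposite-side : ∀ X → X ≢ middle → ∃ (Sides X)
opposite-side upper  _  = lower , upper-lower
opposite-side middle ne = ⊥-elim (ne refl)
opposite-side lower  _  = upper , lower-upper

data Located (P Q X : Path) : Set where
  on-P : X ≡ P → Located P Q X
  on-M : X ≡ middle → Located P Q X
  on-Q : X ≡ Q → Located P Q X

locate : ∀ {P Q} → Sides P Q → ∀ X → Located P Q X
locate upper-lower upper  = on-P refl
locate upper-lower middle = on-M refl
locate upper-lower lower  = on-Q refl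
locate lower-upper upper  = on-Q refl
locate lower-upper middle = on-M refl
locate lower-upper lower  = on-P refl

-- Legality of moves and of mirror replies

module Moves (j k : ℕ) (4≤j : 4 ≤ j) (4≤k : 4 ≤ k) where
  open Driver j k 4≤j 4≤k public

  Nbr : Edge → Edge → Set
  Nbr e f = Next e f ⊎ Next f e

  Nbr? : ∀ e f → Dec (Nbr e f)
  Nbr? e f = Next? e f ⊎-dec Next? f e

  nbr-path : ∀ {e f} → Nbr e f → path f ≡ path e
  nbr-path (inj₁ (p , _)) = sym p
  nbr-path (inj₂ (p , _)) = p

  nbr-irrefl : ∀ {e} → ¬ Nbr e e
  nbr-irrefl (inj₁ (_ , q)) = ℕ.1+n≢n q
  nbr-irrefl (inj₂ (_ , q)) = ℕ.1+n≢n q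

  nbr-mirror : ∀ {e f} → Nbr e f → Nbr (mirror e) (mirror f)
  nbr-mirror (inj₁ n) = inj₂ (mirror-Next n)
  nbr-mirror (inj₂ n) = inj₁ (mirror-Next n)

  nbr-unmirror : ∀ {e f} → Nbr (mirror e) f → Nbr e (mirror f)
  nbr-unmirror {e} {f} n = subst (λ x → Nbr x (mirror f)) (mirror-involutive e) (nbr-mirror n)

  next-unique : ∀ {e f g} → Next e f → Next e g → f ≡ g
  next-unique (p , q) (p′ , q′) = edge-unique (trans (sym p) p′) (trans (sym q) q′)

  next-exists : ∀ e → ¬ AtEnd right e → ∃ (Next e)
  next-exists e ne with edge-at (path e) (ℕ.≤∧≢⇒< (idx<len e) ne)
  ... | f , p , q = f , sym p , sym q

  flip-involutive : ∀ t → flip (flip t) ≡ t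
  flip-involutive left  = refl
  flip-involutive right = refl

  unmirror-AtEnd : ∀ t {e} → AtEnd (flip t) e → AtEnd t (mirror e)
  unmirror-AtEnd t {e} p = subst (λ u → AtEnd u (mirror e)) (flip-involutive t) (mirror-AtEnd (flip t) p)

  end-dichotomy : ∀ t u → u ≡ t ⊎ u ≡ flip t
  end-dichotomy left  left  = inj₁ refl
  end-dichotomy left  right = inj₂ refl
  end-dichotomy right left  = inj₂ refl
  end-dichotomy right right = inj₁ refl

  flow-nbr : ∀ {s e f b} → Flow s → Nbr e f → s e ≡ orient b → s f ≢ orient (not b)
  flow-nbr {b = b} fl (inj₁ n) p q = fl b n p q
  flow-nbr {b = b} fl (inj₂ n) p q = fl (not b) n q (trans p (cong orient (sym (not-involutive b))))

  bool-dichotomy : ∀ (b c : Bool) → c ≡ b ⊎ c ≡ not b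
  bool-dichotomy true  true  = inj₁ refl
  bool-dichotomy true  false = inj₂ refl
  bool-dichotomy false true  = inj₂ refl
  bool-dichotomy false false = inj₁ refl

  flow-agree : ∀ {s e f b c} → Flow s → Nbr e f → s e ≡ orient b → s f ≡ orient c → c ≡ b
  flow-agree {b = b} {c} fl n p q with bool-dichotomy b c
  ... | inj₁ eq = eq
  ... | inj₂ refl = ⊥-elim (flow-nbr fl n p q)

  flow-fill : ∀ {s} e o → Flow s → (∀ f → Nbr e f → s f ≢ orient (not o)) → Flow (update s e o)
  flow-fill {s} e o fl ok {x} {y} b nx p q with x ≟E e | y ≟E e
  ... | yes refl | yes refl = nbr-irrefl (inj₁ nx)
  ... | yes refl | no ne = ok y (inj₁ nx) (trans (sym (update-other s e o ne))
        (trans q (cong (orient ∘ not) (orient-injective (trans (sym p) (update-same s e o))))))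
  ... | no ne | yes refl = ok x (inj₂ nx) (trans (sym (update-other s e o ne)) (trans p
        (cong orient (trans (sym (not-involutive b))
          (cong not (orient-injective (trans (sym q) (update-same s e o))))))))
  ... | no ne | no ne′ = fl b nx (trans (sym (update-other s e o ne)) p)
                                  (trans (sym (update-other s e o ne′)) q)

  good-inner : ∀ {s} e o → Good s → (∀ t → ¬ AtEnd t e) → Flow (update s e o) → Good (update s e o)
  good-inner {s} e o g inner fl = good fl λ t b sat → unsaturated g t b λ f p →
    trans (sym (update-other s e o λ { refl → inner t p })) (sat f p)

  -- If the new edge saturated its end, the other end would be saturated too. No edge lies at both
  -- ends, so that other end is as it was before the move, when it was not saturated.
  good-balanced : ∀ {s} e o → Good s → Flow (update s e o) →
    (∀ t b → Saturated (update s e o) t b → Saturated (update s e o) (flip t) b) → Good (update s e o)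
  good-balanced {s} e o g fl bal = good fl unsat
    where
    avoid : ∀ t b → ¬ AtEnd t e → ¬ Saturated (update s e o) t b
    avoid t b ne sat = unsaturated g t b λ f p →
      trans (sym (update-other s e o λ { refl → ne p })) (sat f p)
    unsat : ∀ t b → ¬ Saturated (update s e o) t b
    unsat t b sat with AtEnd? t e
    ... | no ne  = avoid t b ne sat
    ... | yes at = avoid (flip t) b (not-both-ends t at) (bal t b sat)

  -- Stated path by path, because in `TwoLeft` and `OneLeft` the symmetry is broken on some of the
  -- paths only.
  SymmetricOn : State → Path → Set
  SymmetricOn s X = ∀ f → path f ≡ X → s (mirror f) ≡ s f

  Symmetric : State → Set
  Symmetric s = ∀ f → s (mirror f) ≡ s f

  symmetric⇒balanced : ∀ {s} → Symmetric s → ∀ t b → Saturated s t b → Saturated s (flip t) b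
  symmetric⇒balanced sy t b sat f p = trans (sym (sy f)) (sat (mirror f) (unmirror-AtEnd t p))

  mirror-free : ∀ {s} e o → SymmetricOn s (path e) → mirror e ≢ e → s e ≡ undir →
                update s e o (mirror e) ≡ undir
  mirror-free {s} e o sy ne u = trans (update-other s e o ne) (trans (sy e refl) u)

  mirrored : State → Edge → Bool → State
  mirrored s e o = update (update s e o) (mirror e) o

  mirrored-other : ∀ s e o {f} → f ≢ e → f ≢ mirror e → mirrored s e o f ≡ s f
  mirrored-other s e o ne ne′ = trans (update-other _ (mirror e) o ne′) (update-other s e o ne)

  mirrored-same : ∀ s e o → mirrored s e o e ≡ orient o
  mirrored-same s e o with e ≟E mirror e
  ... | yes eq = trans (cong (mirrored s e o) eq) (update-same _ (mirror e) o)
  ... | no ne  = trans (update-other _ (mirror e) o ne) (update-same s e o)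

  mirrored-directed : ∀ {s} e o {f b} → SymmetricOn s (path e) → s e ≡ undir → s f ≡ orient b →
                      mirrored s e o f ≡ orient b
  mirrored-directed {s} e o {f} sy u p = trans
    (mirrored-other s e o (λ { refl → undirected-≢ {s} u p refl })
                          (λ { refl → undirected-≢ {s} (trans (sy e refl) u) p refl })) p

  mirrored-undirected : ∀ {s} e o {f} → mirrored s e o f ≡ undir → f ≢ e × f ≢ mirror e × s f ≡ undir
  mirrored-undirected {s} e o u with update-undirected (update s e o) o u
  ... | ne′ , u′ with update-undirected s o u′
  ... | ne , u″ = ne , ne′ , u″

  mirrored-symmetricOn : ∀ {s} e o {X} → SymmetricOn s X → SymmetricOn (mirrored s e o) X
  mirrored-symmetricOn {s} e o sy f p with f ≟E e
  ... | yes refl = trans (update-same _ (mirror e) o) (sym (mirrored-same s e o))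
  ... | no ne with f ≟E mirror e
  ...   | yes refl = trans (cong (mirrored s e o) (mirror-involutive e))
                       (trans (mirrored-same s e o) (sym (update-same _ (mirror e) o)))
  ...   | no ne′ = trans (mirrored-other s e o (ne′ ∘ mirror-flip) (ne ∘ mirror-injective))
                     (trans (sy f p) (sym (mirrored-other s e o ne ne′)))

  mirrored-symmetric : ∀ {s} e o → Symmetric s → Symmetric (mirrored s e o)
  mirrored-symmetric e o sy f = mirrored-symmetricOn e o (λ f _ → sy f) f refl

  -- A neighbour of the mirror edge other than `e` is the mirror image of a neighbour of `e` and is
  -- in the same state, so a clash there would already have been a clash at `e`.
  mirrored-flow : ∀ {s} e o → SymmetricOn s (path e) → Flow (update s e o) → Flow (mirrored s e o)
  mirrored-flow {s} e o sy fl = flow-fill (mirror e) o fl ok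
    where
    ok : ∀ f → Nbr (mirror e) f → update s e o f ≢ orient (not o)
    ok f n p with f ≟E e
    -- The central pair of an even path: the mirror edge is adjacent to `e` and copies its
    -- direction.
    ... | yes refl = not-opposite (update-same s e o) p
    ... | no ne = flow-nbr fl (nbr-unmirror n) (update-same s e o)
          (trans (update-other s e o mf≢e) (trans (sy f pf) (trans (sym (update-other s e o ne)) p)))
      where
      pf : path f ≡ path e
      pf = trans (nbr-path n) (path-mirror e)
      mf≢e : mirror f ≢ e
      mf≢e eq = nbr-irrefl (subst (λ x → Nbr x f) (sym (mirror-flip eq)) n)

  mirrored-good : ∀ {s} e o → Symmetric s → Good (update s e o) → Good (mirrored s e o)
  mirrored-good e o sy g = good-balanced (mirror e) o g (mirrored-flow e o (λ f _ → sy f) (flow g))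
    (symmetric⇒balanced (mirrored-symmetric e o sy))

  Centre : Edge → Set
  Centre c = mirror c ≡ c

  centre-inner : ∀ {c} → Centre c → ∀ t → ¬ AtEnd t c
  centre-inner {c} mc t p = not-both-ends t p (subst (AtEnd (flip t)) mc (mirror-AtEnd t p))

  centre-idx : ∀ {c} → Centre c → idx c + suc (idx c) ≡ len (path c)
  centre-idx {c} mc = trans (cong (λ x → idx x + suc (idx c)) (sym mc)) (idx-mirror c)

  centre-unique : ∀ {c c′} → Centre c → Centre c′ → path c ≡ path c′ → c ≡ c′
  centre-unique {c} {c′} mc mc′ p with ℕ.<-cmp (idx c) (idx c′)
  ... | tri≈ _ q _ = edge-unique p q
  ... | tri< q _ _ = ⊥-elim (ℕ.<⇒≢ (ℕ.+-mono-< q (s≤s q))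
          (trans (centre-idx mc) (trans (cong len p) (sym (centre-idx mc′)))))
  ... | tri> _ _ q = ⊥-elim (ℕ.<⇒≢ (ℕ.+-mono-< q (s≤s q))
          (trans (centre-idx mc′) (trans (cong len (sym p)) (sym (centre-idx mc)))))

  -- The two neighbours of a centre are mirror images and so in the same state; the centre can
  -- follow them. It lies at neither end, so it saturates nothing.
  centre-reply : ∀ {s c} → Centre c → SymmetricOn s (path c) → Good s → ∃ λ o → Good (update s c o)
  centre-reply {s} {c} mc sy g = dir (s y) , good-inner c (dir (s y)) g (centre-inner mc)
      (flow-fill c (dir (s y)) (flow g) λ f n p → fits (s y) (trans (sym (nbr-value f n)) p))
    where
    Y = next-exists c (centre-inner mc right)
    y = proj₁ Y
    nbr-value : ∀ f → Nbr c f → s f ≡ s y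
    nbr-value f (inj₁ n) = cong s (next-unique n (proj₂ Y))
    nbr-value f (inj₂ n) = trans (sym (sy f (proj₁ n)))
      (cong s (next-unique (subst (λ x → Next x (mirror f)) mc (mirror-Next n)) (proj₂ Y)))
    dir : Dir → Bool
    -- Both neighbours are undirected here, so either direction would do.
    dir undir = true
    dir fwd   = true
    dir bwd   = false
    fits : ∀ z → z ≢ orient (not (dir z))
    fits undir ()
    fits fwd ()
    fits bwd ()

  open-edge⇒¬Cyclic : ∀ {s f X b} → s f ≡ undir → path f ≡ X ⊎ path f ≡ middle → ¬ Cyclic s X b
  open-edge⇒¬Cyclic u (inj₁ p) (c , _) = orient≢undir (trans (sym (c _ p)) u)
  open-edge⇒¬Cyclic u (inj₂ p) (_ , c) = orient≢undir (trans (sym (c _ p)) u)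

  no-cycle-through : ∀ {s} e o → NoCycle s →
    (∀ X b → X ≢ middle → path e ≡ X ⊎ path e ≡ middle → ¬ Cyclic (update s e o) X b) →
    NoCycle (update s e o)
  no-cycle-through {s} e o nc blocked X b ne cyc@(cX , cM) with path e ≟P X | path e ≟P middle
  ... | yes p | _     = blocked X b ne (inj₁ p) cyc
  ... | no _  | yes p = blocked X b ne (inj₂ p) cyc
  ... | no p  | no p′ = nc X b ne
        ( (λ f q → trans (sym (update-other s e o λ { refl → p q })) (cX f q))
        , (λ f q → trans (sym (update-other s e o λ { refl → p′ q })) (cM f q)))

  -- A cell contains each path entirely or not at all, so an open edge on the path of `e` blocks
  -- every cell that this move could complete.
  no-cycle-beside : ∀ {s} e o {f} → NoCycle s → path f ≡ path e → update s e o f ≡ undir →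
                    NoCycle (update s e o)
  no-cycle-beside e o nc p u = no-cycle-through e o nc λ X b ne at →
    open-edge⇒¬Cyclic u ([ inj₁ ∘ trans p , inj₂ ∘ trans p ]′ at)

  no-cycle-middle : ∀ {s f} → path f ≡ middle → s f ≡ undir → NoCycle s
  no-cycle-middle p u X b ne = open-edge⇒¬Cyclic u (inj₂ p)

  -- Propagation of directions along a path

  run : ∀ {s} → Flow s → ∀ n {x y b} → path x ≡ path y → n + idx x ≡ idx y →
        (∀ g → path g ≡ path x → idx x ≤ idx g → idx g ≤ idx y → s g ≢ undir) →
        s x ≡ orient b → s y ≡ orient b
  run {s} fl zero p q dirs sx = trans (cong s (sym (edge-unique p q))) sx
  run {s} fl (suc n) {x} {y} {b} p q dirs sx
    with edge-at (path x) {suc (idx x)} (ℕ.≤-<-trans (ℕ.≤-trans (s≤s (ℕ.m≤n+m (idx x) n)) (ℕ.≤-reflexive q))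
                            (subst (idx y <_) (cong len (sym p)) (idx<len y)))
  ... | z , pz , qz with undirected-or-directed (s z)
  ...   | inj₁ u = ⊥-elim (dirs z pz (ℕ.≤-trans (ℕ.n≤1+n _) (ℕ.≤-reflexive (sym qz)))
                     (ℕ.≤-trans (ℕ.≤-reflexive qz) (ℕ.≤-trans (s≤s (ℕ.m≤n+m (idx x) n)) (ℕ.≤-reflexive q))) u)
  ...   | inj₂ (c , sz) = run fl n (trans pz p)
            (trans (trans (cong (n +_) qz) (ℕ.+-suc n (idx x))) q)
            (λ g pg l u → dirs g (trans pg pz)
               (ℕ.≤-trans (ℕ.≤-trans (ℕ.n≤1+n _) (ℕ.≤-reflexive (sym qz))) l) u)
            (trans sz (cong orient (flow-agree fl (inj₁ (sym pz , sym qz)) sx sz)))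

  -- The strict inequalities leave a centre outside both halves: it may be open, and directions do
  -- not propagate across an open edge.
  Half : End → Edge → Set
  Half left  e = idx e < idx (mirror e)
  Half right e = idx (mirror e) < idx e

  half : ∀ e → ¬ Centre e → ∃ λ h → Half h e
  half e nc with ℕ.<-cmp (idx e) (idx (mirror e))
  ... | tri< p _ _ = left , p
  ... | tri≈ _ p _ = ⊥-elim (nc (edge-unique (path-mirror e) (sym p)))
  ... | tri> _ _ p = right , p

  half-mirror : ∀ h {e} → Half h e → Half (flip h) (mirror e)
  half-mirror left  {e} p = subst (λ x → idx x < idx (mirror e)) (sym (mirror-involutive e)) p
  half-mirror right {e} p = subst (λ x → idx (mirror e) < idx x) (sym (mirror-involutive e)) p

  halves-disjoint : ∀ h {e} → Half h e → ¬ Half (flip h) e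
  halves-disjoint left  = ℕ.<-asym
  halves-disjoint right = ℕ.<-asym

  mirror-antitone : ∀ {e f} → path e ≡ path f → idx e ≤ idx f → idx (mirror f) ≤ idx (mirror e)
  mirror-antitone {e} {f} p q = ℕ.+-cancelʳ-≤ (suc (idx e)) _ _ (begin
    idx (mirror f) + suc (idx e) ≤⟨ ℕ.+-monoʳ-≤ (idx (mirror f)) (s≤s q) ⟩
    idx (mirror f) + suc (idx f) ≡⟨ idx-mirror f ⟩
    len (path f)                 ≡⟨ cong len p ⟨
    len (path e)                 ≡⟨ idx-mirror e ⟨
    idx (mirror e) + suc (idx e) ∎)
    where open ℕ.≤-Reasoning

  half-convex : ∀ h {x y g} → path g ≡ path x → path g ≡ path y → idx x ≤ idx g → idx g ≤ idx y →
                Half h x → Half h y → Half h g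
  half-convex left  px py l u _ hy = ℕ.≤-<-trans u (ℕ.<-≤-trans hy (mirror-antitone py u))
  half-convex right px py l u hx _ = ℕ.≤-<-trans (mirror-antitone (sym px) l) (ℕ.<-≤-trans hx l)

  -- Directions propagate from e along its half of the path, and from there to the other half by symmetry.
  last-pair-uniform : ∀ {s} e o → Symmetric s → Flow (update s e o) → ¬ Centre e →
    (∀ g → path g ≡ path e → ¬ Centre g → g ≢ e → g ≢ mirror e → s g ≢ undir) →
    ∀ f → path f ≡ path e → ¬ Centre f → f ≢ mirror e → update s e o f ≡ orient o
  last-pair-uniform {s} e o sy fl nce full f pf ncf f≢me with half e nce
  ... | h , he = by-half (half f ncf)
    where
    s₁ = update s e o

    directed : ∀ g → path g ≡ path e → Half h g → s₁ g ≢ undir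
    directed g pg hg u with update-undirected s {e} o u
    ... | g≢e , ug = full g pg nc g≢e g≢me ug
      where
      nc : ¬ Centre g
      nc mg = halves-disjoint h hg (subst (Half (flip h)) mg (half-mirror h hg))
      g≢me : g ≢ mirror e
      g≢me refl = halves-disjoint h hg (half-mirror h he)

    same-half : ∀ g → path g ≡ path e → Half h g → s₁ g ≡ orient o
    same-half g pg hg with ℕ.≤-total (idx e) (idx g)
    ... | inj₁ le = run fl (idx g ∸ idx e) (sym pg) (ℕ.m∸n+n≡m le)
          (λ x px l u → directed x px (half-convex h px (trans px (sym pg)) l u he hg)) (update-same s e o)
    ... | inj₂ ge with undirected-or-directed (s₁ g)
    ...   | inj₁ u = ⊥-elim (directed g pg hg u)
    ...   | inj₂ (b , sg) = trans sg (cong orient (orient-injective (trans (sym se) (update-same s e o))))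
      where
      se : s₁ e ≡ orient b
      se = run fl (idx e ∸ idx g) pg (ℕ.m∸n+n≡m ge)
          (λ x px l u → directed x (trans px pg) (half-convex h px (trans px pg) l u hg he)) sg

    other-half : ∀ g → path g ≡ path e → Half (flip h) g → g ≢ mirror e → s₁ g ≡ orient o
    other-half g pg hg g≢me with g ≟E e
    ... | yes refl = update-same s e o
    ... | no g≢e = trans (trans (update-other s e o g≢e) (trans (sym (sy g))
            (sym (update-other s e o (g≢me ∘ mirror-flip)))))
          (same-half (mirror g) (trans (path-mirror g) pg)
            (subst (λ x → Half x (mirror g)) (flip-involutive h) (half-mirror (flip h) hg)))

    by-half : (∃ λ h′ → Half h′ f) → s₁ f ≡ orient o
    by-half (h′ , hf) with end-dichotomy h h′
    ... | inj₁ refl = same-half f pf hf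
    ... | inj₂ refl = other-half f pf hf f≢me

-- Gaps in a sequence of directions

ext : ∀ n → (Fin n → Dir) → Dir → ℕ → Dir
ext zero    f r _       = r
ext (suc n) f r zero    = f fz
ext (suc n) f r (suc i) = ext n (f ∘ fs) r i

ext-< : ∀ n {f r i} (i<n : i < n) → ext n f r i ≡ f (fromℕ< i<n)
ext-< (suc n) {i = zero}  _   = refl
ext-< (suc n) {i = suc i} i<n = ext-< n (s≤s⁻¹ i<n)

ext-n : ∀ n {f r} → ext n f r n ≡ r
ext-n zero    = refl
ext-n (suc n) = ext-n n

-- Entry `i + 1` is edge `i`. A sentinel on either side gives the end edges two neighbours as well.
seq : Dir → ∀ n → (Fin n → Dir) → Dir → ℕ → Dir
seq p n f r zero    = p
seq p n f r (suc i) = ext n f r i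

Coherent : ℕ → (ℕ → Dir) → Set
Coherent n g = ∀ i → i ≤ n → ∀ b → g i ≡ orient b → g (suc i) ≢ orient (not b)

GapsReverse : ℕ → (ℕ → Dir) → Set
GapsReverse n g = ∀ i → i < n → g (suc i) ≡ undir →
  ∃ λ b → g i ≡ orient b × g (suc (suc i)) ≡ orient (not b)

-- Read from left to right, the direction changes exactly at the gaps, so counting gaps modulo 2
-- compares the two sentinels.
gap-parity : ∀ n f x y → Coherent n (seq (orient x) n f (orient y)) →
  GapsReverse n (seq (orient x) n f (orient y)) → odd (#undirected n f) ≡ x xor y
gap-parity zero f x y coh gaps with x Bool.≟ y
... | yes refl = sym (xor-same x)
... | no ne = ⊥-elim (coh 0 z≤n x refl (cong orient (¬-not (ne ∘ sym))))
gap-parity (suc n) f x y coh gaps with undirected-or-directed (f fz)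
... | inj₂ (z , p) rewrite p | undirected-orient z = trans
      (gap-parity n (f ∘ fs) z y coh′ gaps′)
      (cong (_xor y) (orient-agree (λ q → coh 0 z≤n x refl (trans p q))))
  where
  orient-agree : orient z ≢ orient (not x) → z ≡ x
  orient-agree ne with z Bool.≟ x
  ... | yes eq = eq
  ... | no z≢x = ⊥-elim (ne (cong orient (¬-not z≢x)))
  coh′ : Coherent n (seq (orient z) n (f ∘ fs) (orient y))
  coh′ zero    i≤n b q = coh 1 (s≤s i≤n) b (trans p q)
  coh′ (suc i) i≤n = coh (suc (suc i)) (s≤s i≤n)
  gaps′ : GapsReverse n (seq (orient z) n (f ∘ fs) (orient y))
  gaps′ zero    i<n u with gaps 1 (s≤s i<n) u
  ... | b , q , r = b , trans (sym p) q , r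
  gaps′ (suc i) i<n = gaps (suc (suc i)) (s≤s i<n)
-- A gap at the front: the recursion continues with the reversed direction as left sentinel, in the
-- place of the undirected entry.
... | inj₁ u with gaps 0 (s≤s z≤n) u
...   | b , p , q with orient-injective {x} {b} p
...     | refl rewrite u = trans
            (cong not (gap-parity n (f ∘ fs) (not x) y coh′ gaps′))
            (trans (cong not (sym (not-distribˡ-xor x y))) (not-involutive _))
  where
  coh′ : Coherent n (seq (orient (not x)) n (f ∘ fs) (orient y))
  coh′ zero    i≤n c r r′ = not-opposite {b = not x} q (trans r′ (cong (orient ∘ not) (sym (orient-injective r))))
  coh′ (suc i) i≤n = coh (suc (suc i)) (s≤s i≤n)
  gaps′ : GapsReverse n (seq (orient (not x)) n (f ∘ fs) (orient y))
  gaps′ zero    i<n u′ = ⊥-elim (orient≢undir (trans (sym q) u′))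
  gaps′ (suc i) i<n = gaps (suc (suc i)) (s≤s i<n)

-- Positions with both cells spoiled

module Endgame (j k : ℕ) (4≤j : 4 ≤ j) (4≤k : 4 ≤ k) where
  open Moves j k 4≤j 4≤k public

  -- Both cells are spoiled, and at both ends P and the middle path can only be directed along d.
  record Dead (P Q : Path) (d : Bool) (s : State) : Set where
    field
      sides     : Sides P Q
      middle-d  : ∃ λ f → path f ≡ middle × s f ≡ orient d
      near-ends : ∀ t {e f} → path e ≡ P → AtEnd t e → Nbr e f → s f ≡ orient d
      side-d    : ∃ λ f → path f ≡ Q × s f ≡ orient d

  Good? : ∀ s → Dec (Good s)
  Good? s = map′
    (λ { (fl , l₁ , l₂ , r₁ , r₂) → good
      (λ { {e} {f} true n p q → proj₁ (fl e f n) (p , q) ; {e} {f} false n p q → proj₂ (fl e f n) (p , q) })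
      λ { left true → l₁ ; left false → l₂ ; right true → r₁ ; right false → r₂ } })
    (λ g → (λ e f n → (λ { (p , q) → flow g true n p q }) , (λ { (p , q) → flow g false n p q }))
         , unsaturated g left true , unsaturated g left false
         , unsaturated g right true , unsaturated g right false)
    (all-edges? (λ e → all-edges? λ f → Next? e f →-dec
        (¬? ((s e ≟D fwd) ×-dec (s f ≟D bwd)) ×-dec ¬? ((s e ≟D bwd) ×-dec (s f ≟D fwd))))
      ×-dec (unsat? left true ×-dec (unsat? left false ×-dec (unsat? right true ×-dec unsat? right false))))
    where
    unsat? : ∀ t b → Dec (¬ Saturated s t b)
    unsat? t b = ¬? (all-edges? λ e → AtEnd? t e →-dec (s e ≟D orient b))

  end-edge : ∀ t X → ∃ λ e → path e ≡ X × AtEnd t e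
  end-edge left  X = edge-at X (0<len X)
  end-edge right X with edge-at X {len X ∸ 1} (ℕ.∸-monoʳ-< (s≤s z≤n) (0<len X))
  ... | e , p , q = e , p , trans (cong suc q) (trans (ℕ.m+[n∸m]≡n (0<len X)) (cong len (sym p)))

  end-unique : ∀ t {e f} → path e ≡ path f → AtEnd t e → AtEnd t f → e ≡ f
  end-unique left  p q r = edge-unique p (trans q (sym r))
  end-unique right p q r = edge-unique p (ℕ.suc-injective (trans q (trans (cong len p) (sym r))))

  end-nbr : ∀ t e → AtEnd t e → ∃ (Nbr e)
  end-nbr left  e p with next-exists e (not-both-ends left p)
  ... | f , n = f , inj₁ n
  end-nbr right e p with next-exists (mirror e) (not-both-ends left (mirror-AtEnd right p))
  ... | f , n = mirror f , nbr-unmirror (inj₁ n)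

  end-nbr-unique : ∀ t {e f g} → AtEnd t e → Nbr e f → Nbr e g → f ≡ g
  end-nbr-unique left p (inj₁ n) (inj₁ n′) = next-unique n n′
  end-nbr-unique left p (inj₂ (_ , q)) _ = case trans q p of λ ()
  end-nbr-unique left p (inj₁ _) (inj₂ (_ , q)) = case trans q p of λ ()
  end-nbr-unique right {e} {f} p (inj₁ (q , r)) _ =
    ⊥-elim (ℕ.<-irrefl (trans (sym r) (trans p (cong len q))) (idx<len f))
  end-nbr-unique right {e} {f} {g} p (inj₂ _) (inj₁ (q , r)) =
    ⊥-elim (ℕ.<-irrefl (trans (sym r) (trans p (cong len q))) (idx<len g))
  end-nbr-unique right p (inj₂ (q , r)) (inj₂ (q′ , r′)) =
    edge-unique (trans q (sym q′)) (ℕ.suc-injective (trans r (sym r′)))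

  -- `stuck` describes a terminal position. Its number of undirected edges turns out to be even, so
  -- a dead position with an odd number has a legal move.
  module Stuck {P Q : Path} {d : Bool} {s : State} (g : Good s) (dead : Dead P Q d s)
               (stuck : ∀ e o → s e ≡ undir → ¬ Good (update s e o)) where
    open Dead dead

    opposed? : ∀ e o → Dec (∃ λ f → Nbr e f × s f ≡ orient (not o))
    opposed? e o = any-edge? λ f → Nbr? e f ×-dec (s f ≟D orient (not o))

    stuck-inner : ∀ {e} → s e ≡ undir → (∀ t → ¬ AtEnd t e) → ∀ o → ∃ λ f → Nbr e f × s f ≡ orient (not o)
    stuck-inner {e} u inner o with opposed? e o
    ... | yes f = f
    ... | no none = ⊥-elim (stuck e o u (good-inner e o g inner
          (flow-fill e o (flow g) λ f n p → none (f , n , p))))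

    stuck-end : ∀ t {e} → s e ≡ undir → AtEnd t e → ∀ o →
      (∃ λ f → Nbr e f × s f ≡ orient (not o)) ⊎ (∀ f → AtEnd t f → f ≢ e → s f ≡ orient o)
    stuck-end t {e} u at o with opposed? e o
    ... | yes f = inj₁ f
    ... | no none with all-edges? (λ f → AtEnd? t f →-dec (¬? (f ≟E e) →-dec (s f ≟D orient o)))
    ...   | yes sat = inj₂ sat
    ...   | no unsat = ⊥-elim (stuck e o u (good (flow-fill e o (flow g) λ f n p → none (f , n , p)) ok))
      where
      ok : ∀ u b → ¬ Saturated (update s e o) u b
      ok u b sat with end-dichotomy t u
      ... | inj₁ refl = unsat λ f p ne → trans (sym (update-other s e o ne)) (trans (sat f p)
              (trans (sym (sat e at)) (update-same s e o)))
      ... | inj₂ refl = unsaturated g (flip t) b λ f p →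
              trans (sym (update-other s e o λ { refl → not-both-ends t at p })) (sat f p)

    end : End → Path → Edge
    end t X = proj₁ (end-edge t X)

    end-path : ∀ t X → path (end t X) ≡ X
    end-path t X = proj₁ (proj₂ (end-edge t X))

    end-at : ∀ t X → AtEnd t (end t X)
    end-at t X = proj₂ (proj₂ (end-edge t X))

    -- An undirected edge at an end of a path counts as directed against d.
    virtual : Dir → Bool
    virtual undir = not d
    virtual fwd   = true
    virtual bwd   = false

    virtual-orient : ∀ {z b} → z ≡ orient b → virtual z ≡ b
    virtual-orient {b = true}  refl = refl
    virtual-orient {b = false} refl = refl

    virtual-undir : ∀ {z} → z ≡ undir → virtual z ≡ not d
    virtual-undir refl = refl

    -- In a dead position the end edges of `P` and of the middle path are of this kind: the
    -- direction against `d` is excluded for them.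
    Soft : Edge → Set
    Soft e = s e ≡ orient d ⊎ (s e ≡ undir × (∀ f → Nbr e f → s f ≡ orient d))

    soft : ∀ t e → AtEnd t e → (∀ f → Nbr e f → s f ≡ orient d) → Soft e
    soft t e at near with undirected-or-directed (s e) | end-nbr t e at
    ... | inj₁ u | _ = inj₂ (u , near)
    ... | inj₂ (b , p) | f , n = inj₁ (trans p (cong orient (sym (flow-agree (flow g) n p (near f n)))))

    soft-P : ∀ t → Soft (end t P)
    soft-P t = soft t (end t P) (end-at t P) λ f → near-ends t (end-path t P) (end-at t P)

    nbr-of-two : ∀ {e f} → path e ≡ middle → path f ≡ middle → e ≢ f → ∀ g → Nbr e g → g ≡ f
    nbr-of-two {inj₁ _} () _ _ _ _
    nbr-of-two {inj₂ (inj₂ _)} () _ _ _ _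
    nbr-of-two {inj₂ (inj₁ _)} {inj₁ _} _ () _ _ _
    nbr-of-two {inj₂ (inj₁ _)} {inj₂ (inj₂ _)} _ () _ _ _
    nbr-of-two {inj₂ (inj₁ fz)} {inj₂ (inj₁ fz)} _ _ ne _ _ = ⊥-elim (ne refl)
    nbr-of-two {inj₂ (inj₁ (fs fz))} {inj₂ (inj₁ (fs fz))} _ _ ne _ _ = ⊥-elim (ne refl)
    nbr-of-two {inj₂ (inj₁ fz)} {inj₂ (inj₁ (fs fz))} _ _ _ g n =
      end-nbr-unique left refl n (inj₁ (refl , refl))
    nbr-of-two {inj₂ (inj₁ (fs fz))} {inj₂ (inj₁ fz)} _ _ _ g n =
      end-nbr-unique right refl n (inj₂ (refl , refl))

    soft-M : ∀ t → Soft (end t middle)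
    soft-M t with middle-d
    ... | m , pm , sm with end t middle ≟E m
    ...   | yes eq = inj₁ (trans (cong s eq) sm)
    ...   | no ne = soft t (end t middle) (end-at t middle) λ f n →
            trans (cong s (nbr-of-two (end-path t middle) pm ne f n)) sm

    end≢ : ∀ t {X Y} → X ≢ Y → end t X ≢ end t Y
    end≢ t ne eq = ne (trans (sym (end-path t _)) (trans (cong path eq) (end-path t _)))

    P≢M : P ≢ middle
    P≢M = side≢middle sides

    Q≢M : Q ≢ middle
    Q≢M = side≢middle (swap-sides sides)

    soft-stuck : ∀ t X {Y} → Y ≢ X → s (end t X) ≡ undir →
      (∀ f → Nbr (end t X) f → s f ≡ orient d) → s (end t Y) ≡ orient d
    soft-stuck t X {Y} ne u near with stuck-end t u (end-at t X) d
    ... | inj₁ (f , n , p) = ⊥-elim (not-opposite (near f n) p)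
    ... | inj₂ sat = sat (end t Y) (end-at t Y) (end≢ t ne)

    saturate : ∀ t {b} → s (end t P) ≡ orient b → s (end t middle) ≡ orient b → s (end t Q) ≡ orient b →
               Saturated s t b
    saturate t p m q e at with locate sides (path e)
    ... | on-P eq = trans (cong s (end-unique t (trans eq (sym (end-path t P))) at (end-at t P))) p
    ... | on-M eq = trans (cong s (end-unique t (trans eq (sym (end-path t middle))) at (end-at t middle))) m
    ... | on-Q eq = trans (cong s (end-unique t (trans eq (sym (end-path t Q))) at (end-at t Q))) q

    dir-at : End → Path → Bool
    dir-at t X = virtual (s (end t X))

    -- This makes an undirected end edge a genuine reversal: the virtual direction beyond it is
    -- against `d`, the edge next to it is along `d`.
    NearGap : End → Path → Set
    NearGap t X = s (end t X) ≡ undir → ∃ λ f → Nbr (end t X) f × s f ≡ orient d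

    near-gap : ∀ t X → (∀ f → Nbr (end t X) f → s f ≡ orient d) → NearGap t X
    near-gap t X near u with end-nbr t (end t X) (end-at t X)
    ... | f , n = f , n , near f n

    no-gap : ∀ t X {b} → s (end t X) ≡ orient b → NearGap t X
    no-gap t X p u = ⊥-elim (orient≢undir (trans (sym p) u))

    private
      first-not : ∀ {x y z} → x ≡ not d → y ≡ d → z ≡ d → x xor (y xor z) ≡ not d
      first-not refl refl refl = trans (cong (not d xor_) (xor-same d)) (xor-identityʳ _)

      second-not : ∀ {x y z} → x ≡ d → y ≡ not d → z ≡ d → x xor (y xor z) ≡ not d
      second-not refl refl refl = go d
        where
        go : ∀ b → b xor (not b xor b) ≡ not b
        go true  = refl
        go false = refl

      third-not : ∀ {x y z} → x ≡ d → y ≡ d → z ≡ not d → x xor (y xor z) ≡ not d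
      third-not refl refl refl = trans (sym (xor-assoc d d (not d))) (cong (_xor not d) (xor-same d))

    -- Exactly one of the three virtual directions is against `d`. An undirected end edge of `P` or
    -- of the middle path can be blocked along `d` only because the two other edges at the vertex
    -- are along `d`. If the end edges of `P` and of the middle path are both along `d`, a directed
    -- edge of `Q` must oppose them to avoid saturation, and an undirected one counts as against
    -- `d`.
    end-analysis : ∀ t → (dir-at t P xor (dir-at t middle xor dir-at t Q) ≡ not d)
                       × NearGap t P × NearGap t middle × NearGap t Q
    end-analysis t with soft-P t | soft-M t
    ... | inj₂ (u , near) | _ =
        first-not (virtual-undir u) (virtual-orient m) (virtual-orient q)
      , near-gap t P near , no-gap t middle m , no-gap t Q q
      where
      m = soft-stuck t P (P≢M ∘ sym) u near
      q = soft-stuck t P (sides-differ sides ∘ sym) u near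
    ... | inj₁ p | inj₂ (u , near) =
        second-not (virtual-orient p) (virtual-undir u) (virtual-orient q)
      , no-gap t P p , near-gap t middle near , no-gap t Q q
      where
      q = soft-stuck t middle Q≢M u near
    ... | inj₁ p | inj₁ m = third-not (virtual-orient p) (virtual-orient m) q
      , no-gap t P p , no-gap t middle m , gap
      where
      q : dir-at t Q ≡ not d
      q with undirected-or-directed (s (end t Q))
      ... | inj₁ u = virtual-undir u
      ... | inj₂ (b , p′) with bool-dichotomy d b
      ...   | inj₁ refl = ⊥-elim (unsaturated g t d (saturate t p m p′))
      ...   | inj₂ refl = virtual-orient p′
      -- Saturation cannot bar the direction against `d`, as the edge of `P` is along `d`. So a
      -- neighbour along `d` bars it.
      gap : NearGap t Q
      gap u with stuck-end t u (end-at t Q) (not d)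
      ... | inj₁ (f , n , r) = f , n , trans r (cong orient (not-involutive d))
      ... | inj₂ sat = ⊥-elim (not-opposite p (sat (end t P) (end-at t P) (end≢ t (sides-differ sides))))

    near-gaps : ∀ t X → NearGap t X
    near-gaps t X with locate sides X | end-analysis t
    ... | on-P refl | _ , p , _ , _ = p
    ... | on-M refl | _ , _ , m , _ = m
    ... | on-Q refl | _ , _ , _ , q = q

    -- The sentinels are the virtual directions of the end edges: beyond a directed end edge its own
    -- direction is repeated, across an undirected one there is a reversal.
    path-parity : ∀ X → odd (#undirected (len X) (s ∘ edge X)) ≡ dir-at left X xor dir-at right X
    path-parity X = gap-parity n (s ∘ edge X) (dir-at left X) (dir-at right X) coherent gaps
      where
      n = len X
      x = dir-at left X
      y = dir-at right X
      h : ℕ → Dir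
      h = seq (orient x) n (s ∘ edge X) (orient y)

      value : ∀ {e} → path e ≡ X → h (suc (idx e)) ≡ s e
      value {e} refl = trans (ext-< n (idx<len e))
        (cong s (edge-unique (path-edge X _) (trans (idx-edge X _) (Fin.toℕ-fromℕ< _))))

      last-value : ∀ {e} → path e ≡ X → AtEnd right e → h (suc (suc (idx e))) ≡ orient y
      last-value {e} refl at = trans (cong (ext n (s ∘ edge X) (orient y)) at) (ext-n n)

      first-edge : ∀ {e} → path e ≡ X → idx e ≡ 0 → e ≡ end left X
      first-edge p q = end-unique left (trans p (sym (end-path left X))) q (end-at left X)

      last-edge : ∀ {e} → path e ≡ X → AtEnd right e → e ≡ end right X
      last-edge p q = end-unique right (trans p (sym (end-path right X))) q (end-at right X)

      data At : ℕ → Set where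
        at-edge : ∀ {e} → path e ≡ X → At (idx e)

      at : ∀ {i} → i < n → At i
      at i<n with edge-at X i<n
      ... | e , p , refl = at-edge p

      after : ∀ {e} → path e ≡ X → ∀ {c} → (∀ {f} → Next e f → s f ≡ orient c) →
              (AtEnd right e → y ≡ c) → h (suc (suc (idx e))) ≡ orient c
      after {e} p next last with AtEnd? right e
      ... | yes at = trans (last-value p at) (cong orient (last at))
      ... | no ne with next-exists e ne
      ...   | f , nx = trans (cong (h ∘ suc) (proj₂ nx))
                         (trans (value (trans (sym (proj₁ nx)) p)) (next nx))

      coherent : Coherent n h
      coherent zero _ b p q with at (0<len X)
      ... | a = go a refl
        where
        go : ∀ {i} → At i → i ≡ 0 → ⊥
        go (at-edge {e} pe) i≡0 = not-¬ refl (sym (trans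
          (sym (virtual-orient (trans (sym (trans (cong (h ∘ suc) (sym i≡0))
             (trans (value pe) (cong s (first-edge pe i≡0))))) q)))
          (orient-injective p)))
      coherent (suc i) i<n b p q with at i<n
      ... | at-edge {e} pe with AtEnd? right e
      ...   | yes last = not-¬ refl (trans
              (sym (virtual-orient (trans (cong s (sym (last-edge pe last))) (trans (sym (value pe)) p))))
              (orient-injective (trans (sym (last-value pe last)) q)))
      ...   | no ne with next-exists e ne
      ...     | f , nx = flow g b nx (trans (sym (value pe)) p)
                (trans (sym (trans (cong (h ∘ suc) (proj₂ nx)) (value (trans (sym (proj₁ nx)) pe)))) q)

      gaps : GapsReverse n h
      gaps i i<n u with at i<n
      ... | at-edge {e} pe = go (trans (sym (value pe)) u)
        where
        go : s e ≡ undir → ∃ λ b → h (idx e) ≡ orient b × h (suc (suc (idx e))) ≡ orient (not b)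
        go ue with AtEnd? left e | AtEnd? right e
        ... | yes l | yes r = ⊥-elim (not-both-ends left l r)
        ... | yes l | no nr with first-edge pe l
        ...   | refl with near-gaps left X ue
        ...     | f , inj₂ (_ , q) , _ = case trans q l of λ ()
        ...     | f , inj₁ nx , sf = not d
              , trans (cong h l) (cong orient (virtual-undir ue))
              , after pe (λ nx′ → trans (cong s (next-unique nx′ nx)) (trans sf (cong orient (sym (not-involutive d)))))
                         (⊥-elim ∘ nr)
        go ue | no nl | yes r with last-edge pe r
        ...   | refl with near-gaps right X ue
        ...     | f , inj₁ (q , q′) , _ = ⊥-elim (ℕ.<-irrefl (trans (sym q′) (trans r (cong len q))) (idx<len f))
        ...     | f , inj₂ (q , q′) , sf = d
              , trans (cong h (sym q′)) (trans (value (trans q pe)) sf)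
              , trans (last-value pe r) (cong orient (virtual-undir ue))
        -- An inner gap is blocked in both directions. One neighbour cannot block both, so the two
        -- neighbours have opposite directions.
        go ue | no nl | no nr
          with stuck-inner ue inner true | stuck-inner ue inner false
          where
          inner : ∀ t → ¬ AtEnd t e
          inner left  = nl
          inner right = nr
        ... | f , inj₂ nf , sf | f′ , inj₁ nf′ , sf′ = false
              , trans (cong h (sym (proj₂ nf))) (trans (value (trans (proj₁ nf) pe)) sf)
              , after pe (λ nx → trans (cong s (next-unique nx nf′)) sf′) (⊥-elim ∘ nr)
        ... | f , inj₁ nf , sf | f′ , inj₂ nf′ , sf′ = true
              , trans (cong h (sym (proj₂ nf′))) (trans (value (trans (proj₁ nf′) pe)) sf′)
              , after pe (λ nx → trans (cong s (next-unique nx nf)) sf) (⊥-elim ∘ nr)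
        ... | f , inj₁ nf , sf | f′ , inj₁ nf′ , sf′ =
              case trans (sym sf) (trans (cong s (next-unique nf nf′)) sf′) of λ ()
        ... | f , inj₂ nf , sf | f′ , inj₂ nf′ , sf′ =
              case trans (sym sf) (trans (cong s (edge-unique (trans (proj₁ nf) (sym (proj₁ nf′)))
                (ℕ.suc-injective (trans (proj₂ nf) (sym (proj₂ nf′)))))) sf′) of λ ()

    ends-agree : ∀ t → dir-at t upper xor (dir-at t middle xor dir-at t lower) ≡ not d
    ends-agree t with sides | proj₁ (end-analysis t)
    ... | upper-lower | eq = eq
    ... | lower-upper | eq = trans (x∙yz≈z∙yx (dir-at t upper) (dir-at t middle) (dir-at t lower)) eq

    -- The parities of the three paths add up to the sum of the six virtual end directions.
    -- Regrouped by ends, this is a sum of two equal terms.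
    even-count : odd (count s) ≡ false
    even-count = begin
      odd (count s)
        ≡⟨ odd-+ (u + m) l ⟩
      odd (u + m) xor odd l
        ≡⟨ cong (_xor odd l) (odd-+ u m) ⟩
      (odd u xor odd m) xor odd l
        ≡⟨ cong₂ _xor_ (cong₂ _xor_ (path-parity upper) (path-parity middle)) (path-parity lower) ⟩
      ((u₀ xor u₁) xor (m₀ xor m₁)) xor (l₀ xor l₁)
        ≡⟨ xor-assoc (u₀ xor u₁) (m₀ xor m₁) (l₀ xor l₁) ⟩
      (u₀ xor u₁) xor ((m₀ xor m₁) xor (l₀ xor l₁))
        ≡⟨ cong ((u₀ xor u₁) xor_) (interchange m₀ m₁ l₀ l₁) ⟩
      (u₀ xor u₁) xor ((m₀ xor l₀) xor (m₁ xor l₁))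
        ≡⟨ interchange u₀ u₁ (m₀ xor l₀) (m₁ xor l₁) ⟩
      (u₀ xor (m₀ xor l₀)) xor (u₁ xor (m₁ xor l₁))
        ≡⟨ cong₂ _xor_ (ends-agree left) (ends-agree right) ⟩
      not d xor not d
        ≡⟨ xor-same (not d) ⟩
      false ∎
      where
      open ≡-Reasoning
      u = #undirected j (s ∘ edge upper)
      m = #undirected 2 (s ∘ edge middle)
      l = #undirected k (s ∘ edge lower)
      u₀ = dir-at left upper
      u₁ = dir-at right upper
      m₀ = dir-at left middle
      m₁ = dir-at right middle
      l₀ = dir-at left lower
      l₁ = dir-at right lower

  dead⇒move : ∀ {P Q d s} → Good s → Dead P Q d s → odd (count s) ≡ true →
              ∃ λ e → ∃ λ o → s e ≡ undir × Good (update s e o)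
  dead⇒move {s = s} g dead od
    with any-edge? (λ e → (s e ≟D undir) ×-dec (Good? (update s e true) ⊎-dec Good? (update s e false)))
  ... | yes (e , u , inj₁ g′) = e , true , u , g′
  ... | yes (e , u , inj₂ g′) = e , false , u , g′
  ... | no none = case trans (sym od) (Stuck.even-count g dead stuck) of λ ()
    where
    stuck : ∀ e o → s e ≡ undir → ¬ Good (update s e o)
    stuck e true  u g′ = none (e , u , inj₁ g′)
    stuck e false u g′ = none (e , u , inj₂ g′)

  -- The conditions on the position only ask that certain edges have a direction, and directions are
  -- never revoked.
  dead-update : ∀ {P Q d s} e o → s e ≡ undir → Dead P Q d s → Dead P Q d (update s e o)
  dead-update {s = s} e o u dead = record
    { sides     = sides
    ; middle-d  = let f , p , q = middle-d in f , p , update-directed s o u q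
    ; near-ends = λ t p at n → update-directed s o u (near-ends t p at n)
    ; side-d    = let f , p , q = side-d in f , p , update-directed s o u q
    }
    where open Dead dead

  -- All three paths contain an edge along `d`, whereas a cell needs opposite directions on its
  -- outer path and the middle path.
  dead⇒NoCycle : ∀ {P Q d s} → Dead P Q d s → NoCycle s
  dead⇒NoCycle {P} {Q} {d} {s} dead X b ne (cX , cM) with locate (Dead.sides dead) X
  ... | on-M p = ne p
  ... | on-Q refl = let f , p , q = Dead.side-d dead ; f′ , p′ , q′ = Dead.middle-d dead in
        not-¬ (orient-injective (trans (sym q) (cX f p))) (orient-injective (trans (sym q′) (cM f′ p′)))
  ... | on-P refl = let e , p , at = end-edge left P
                        f , n = end-nbr left e at
                        f′ , p′ , q′ = Dead.middle-d dead in
        not-¬ (orient-injective (trans (sym (Dead.near-ends dead left p at n)) (cX f (trans (nbr-path n) p))))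
              (orient-injective (trans (sym q′) (cM f′ p′)))

-- Invariant positions of the responder

module Strategy (j k : ℕ) (4≤j : 4 ≤ j) (4≤k : 4 ≤ k) where
  open Endgame j k 4≤j 4≤k public

  side-length : ∀ {P Q} → Sides P Q → 4 ≤ len P
  side-length upper-lower = 4≤j
  side-length lower-upper = 4≤k

  sides-cover : ∀ {P Q X} → Sides P Q → X ≢ middle → X ≡ P ⊎ X ≡ Q
  sides-cover {X = X} sd ne with locate sd X
  ... | on-P p = inj₁ p
  ... | on-M p = ⊥-elim (ne p)
  ... | on-Q p = inj₂ p

  middle-pair : ∀ e f → path e ≡ middle → path f ≡ middle → f ≡ e ⊎ f ≡ mirror e
  middle-pair (inj₁ _) _ () _
  middle-pair (inj₂ (inj₂ _)) _ () _
  middle-pair (inj₂ (inj₁ _)) (inj₁ _) _ ()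
  middle-pair (inj₂ (inj₁ _)) (inj₂ (inj₂ _)) _ ()
  middle-pair (inj₂ (inj₁ fz)) (inj₂ (inj₁ fz)) _ _ = inj₁ refl
  middle-pair (inj₂ (inj₁ fz)) (inj₂ (inj₁ (fs fz))) _ _ = inj₂ refl
  middle-pair (inj₂ (inj₁ (fs fz))) (inj₂ (inj₁ fz)) _ _ = inj₂ refl
  middle-pair (inj₂ (inj₁ (fs fz))) (inj₂ (inj₁ (fs fz))) _ _ = inj₁ refl

  middle-nbr : ∀ e → path e ≡ middle → Nbr (mirror e) e
  middle-nbr (inj₁ _) ()
  middle-nbr (inj₂ (inj₂ _)) ()
  middle-nbr (inj₂ (inj₁ fz)) _ = inj₂ (refl , refl)
  middle-nbr (inj₂ (inj₁ (fs fz))) _ = inj₁ (refl , refl)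

  middle-no-centre : ∀ {e} → path e ≡ middle → ¬ Centre e
  middle-no-centre {e} p c = nbr-irrefl (subst (λ x → Nbr x e) c (middle-nbr e p))

  centre-side : ∀ {e} → Centre e → path e ≢ middle
  centre-side c p = middle-no-centre p c

  end-not-centre : ∀ t {e} → AtEnd t e → ¬ Centre e
  end-not-centre t at c = centre-inner c t at

  private
    near-left-idx : ∀ {e f} → AtEnd left e → Nbr e f → idx f ≡ 1
    near-left-idx at (inj₁ (_ , q)) = trans (sym q) (cong suc at)
    near-left-idx at (inj₂ (_ , q)) = case trans q at of λ ()

    -- The neighbour of the first edge has index 1 and could be the centre only of a path with 3
    -- edges, which the bound 4 excludes.
    near-left-not-centre : ∀ {e f} → path e ≢ middle → AtEnd left e → Nbr e f → ¬ Centre f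
    near-left-not-centre {e} {f} ne at n c = ℕ.<-irrefl
      (trans (sym (cong (λ i → i + suc i) (near-left-idx at n)))
        (trans (centre-idx c) (cong len (nbr-path n))))
      (side-length (proj₂ (opposite-side (path e) ne)))

    near-left-inner : ∀ {e f} → path e ≢ middle → AtEnd left e → Nbr e f → ∀ u → ¬ AtEnd u f
    near-left-inner ne at n left p = case trans (sym (near-left-idx at n)) p of λ ()
    near-left-inner {e} ne at n right p = ℕ.<-irrefl
      (trans (sym (cong suc (near-left-idx at n))) (trans p (cong len (nbr-path n))))
      (ℕ.<-trans (ℕ.n<1+n 2) (side-length (proj₂ (opposite-side (path e) ne))))

  near-end-not-centre : ∀ t {e f} → path e ≢ middle → AtEnd t e → Nbr e f → ¬ Centre f
  near-end-not-centre left  ne at n c = near-left-not-centre ne at n c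
  near-end-not-centre right {e} {f} ne at n c =
    near-left-not-centre (ne ∘ trans (sym (path-mirror e))) (mirror-AtEnd right at) (nbr-mirror n) (cong mirror c)

  near-end-inner : ∀ t {e f} → path e ≢ middle → AtEnd t e → Nbr e f → ∀ u → ¬ AtEnd u f
  near-end-inner left  ne at n u p = near-left-inner ne at n u p
  near-end-inner right {e} {f} ne at n u p =
    near-left-inner (ne ∘ trans (sym (path-mirror e))) (mirror-AtEnd right at) (nbr-mirror n)
      (flip u) (mirror-AtEnd u p)

  -- It yields directed neighbours while the centre may be open. An inner edge has two neighbours,
  -- and they cannot both be the centre; for an end edge the length bound settles it.
  non-centre-nbr : ∀ x → path x ≢ middle → ∃ λ y → Nbr x y × ¬ Centre y
  non-centre-nbr x ne with AtEnd? left x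
  ... | yes at = let y , n = end-nbr left x at in y , n , near-end-not-centre left ne at n
  ... | no nl with AtEnd? right x
  ...   | yes at = let y , n = end-nbr right x at in y , n , near-end-not-centre right ne at n
  ...   | no nr with next-exists x nr | next-exists (mirror x) (nl ∘ subst (AtEnd left) (mirror-involutive x) ∘ mirror-AtEnd right)
  ...     | y , n | z , n′ with mirror y ≟E y
  ...       | no nc = y , inj₁ n , nc
  ...       | yes c = mirror z , nbr-unmirror (inj₁ n′) , λ c′ →
                let prev = subst (Next (mirror z)) (mirror-involutive x) (mirror-Next n′)
                    z≡y = centre-unique c′ c (trans (proj₁ prev) (proj₁ n))
                in ℕ.<-irrefl (cong idx z≡y)
                     (ℕ.<-trans (ℕ.≤-reflexive (proj₂ prev)) (ℕ.≤-reflexive (proj₂ n)))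

  update-centre-symmetricOn : ∀ {s c X} o → Centre c → SymmetricOn s X → SymmetricOn (update s c o) X
  update-centre-symmetricOn {s} {c} o mc sy f p with f ≟E c
  ... | yes refl = cong (update s c o) mc
  ... | no ne = trans (update-other s c o λ eq → ne (trans (mirror-flip eq) mc))
                  (trans (sy f p) (sym (update-other s c o ne)))

  off-path : ∀ {s e o f} → path f ≢ path e → update s e o f ≡ s f
  off-path {s} {e} {o} ne = update-other s e o (ne ∘ cong path)

  mirrored-off-path : ∀ {s e o f} → path f ≢ path e → mirrored s e o f ≡ s f
  mirrored-off-path {s} {e} {o} ne = mirrored-other s e o (ne ∘ cong path)
    λ eq → ne (trans (cong path eq) (path-mirror e))

  OpenPair : State → Path → Set
  OpenPair s X = ∃ λ f → path f ≡ X × ¬ Centre f × s f ≡ undir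

  OpenPair? : ∀ s X → Dec (OpenPair s X)
  OpenPair? s X = any-edge? λ f → (path f ≟P X) ×-dec (¬? (mirror f ≟E f) ×-dec (s f ≟D undir))

  Has : State → Path → Bool → Set
  Has s X b = ∃ λ f → path f ≡ X × s f ≡ orient b

  Has? : ∀ s X b → Dec (Has s X b)
  Has? s X b = any-edge? λ f → (path f ≟P X) ×-dec (s f ≟D orient b)

  MiddleOpen : State → Set
  MiddleOpen s = ∀ f → path f ≡ middle → s f ≡ undir

  middle-edge : Edge
  middle-edge = inj₂ (inj₁ fz)

  -- Mirror play with both outer paths odd, up to the moment when a centre is directed.
  record Balanced (s : State) : Set where
    field
      centres   : ∀ X → X ≢ middle → ∃ λ c → path c ≡ X × Centre c
      symmetric : Symmetric s
      open-at   : ∀ {c} → Centre c → s c ≡ undir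

  NearlyAlong : State → Path → Bool → Set
  NearlyAlong s P d = ∀ f → path f ≡ P → ¬ Centre f → s f ≡ orient d

  -- Whoever directs one of p, q lets the opponent direct the other one.
  record TwoLeft (P : Path) (d : Bool) (p q : Edge) (s : State) : Set where
    field
      side       : P ≢ middle
      p≢q        : p ≢ q
      p-on       : path p ≡ P
      q-on       : path q ≡ P
      p-open     : s p ≡ undir
      q-open     : s q ≡ undir
      rest       : ∀ f → path f ≡ P → f ≢ p → f ≢ q → s f ≡ orient d
      p-forced   : ∃ λ y → Nbr p y × s y ≡ orient d
      q-forced   : ∃ λ y → Nbr q y × s y ≡ orient d
      symmetric  : ∀ X → X ≢ P → SymmetricOn s X
      no-centres : ∀ {f} → path f ≢ P → s f ≡ undir → ¬ Centre f
      ends       : (∀ t → ¬ AtEnd t p × ¬ AtEnd t q) ⊎ Along s middle (not d)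

  -- The cell of P lacks only its centre c and the mirror image of m.
  record OneLeft (P Q : Path) (d : Bool) (c m : Edge) (s : State) : Set where
    field
      sides      : Sides P Q
      c-on       : path c ≡ P
      c-centre   : Centre c
      c-open     : s c ≡ undir
      nearly     : NearlyAlong s P d
      m-on       : path m ≡ middle
      m-directed : s m ≡ orient (not d)
      m′-open    : s (mirror m) ≡ undir
      symmetric  : SymmetricOn s Q
      no-centres : ∀ {f} → path f ≡ Q → s f ≡ undir → ¬ Centre f
      spoiled    : Has s Q (not d)

  -- The positions the responder leaves to the opponent.
  data Lost (s : State) : Set where
    paired        : Symmetric s → (∀ {f} → s f ≡ undir → ¬ Centre f) → Lost s
    middle-open   : Balanced s → MiddleOpen s → (∀ X → X ≢ middle → OpenPair s X) → Lost s
    middle-closed : ∀ μ → Balanced s → Along s middle μ →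
                    (∀ X → X ≢ middle → OpenPair s X ⊎ Has s X μ) → Lost s
    side-full     : ∀ {P Q} d → Sides P Q → Balanced s → MiddleOpen s → NearlyAlong s P d →
                    ¬ Has s Q d → Lost s
    two-left      : ∀ {P d p q} → TwoLeft P d p q s → Lost s
    one-left      : ∀ {P Q d c m} → OneLeft P Q d c m s → Lost s
    dead          : ∀ {P Q d} → Dead P Q d s → Lost s

  Answer : State → Edge → Bool → Set
  Answer s e o = NoCycle (update s e o) × Reply Lost (update s e o)

  -- Answers to a single move of the opponent

  module Turn {s : State} (g : Good s) (nc : NoCycle s) (e : Edge) (o : Bool)
              (u : s e ≡ undir) (g₁ : Good (update s e o)) where
    s₁ = update s e o

    mirror-answer : Symmetric s → ¬ Centre e → Lost (mirrored s e o) → Answer s e o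
    mirror-answer sy ne inv =
        no-cycle-beside e o nc (path-mirror e) free
      , reply (mirror e) o free (mirrored-good e o sy g₁) inv
      where
      free = mirror-free e o (λ f _ → sy f) ne u

    mirrored-balanced : Balanced s → ¬ Centre e → Balanced (mirrored s e o)
    mirrored-balanced bal ne = record
      { centres   = centres
      ; symmetric = mirrored-symmetric e o symmetric
      ; open-at   = λ {c} mc → trans
          (mirrored-other s e o (λ { refl → ne mc }) (λ { refl → ne (mirror-injective mc) })) (open-at mc)
      }
      where open Balanced bal

    paired-answer : Symmetric s → (∀ {f} → s f ≡ undir → ¬ Centre f) → Answer s e o
    paired-answer sy none = mirror-answer sy (none u)
      (paired (mirrored-symmetric e o sy) λ uf → none (proj₂ (proj₂ (mirrored-undirected e o uf))))

    module _ (bal : Balanced s) where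
      open Balanced bal

      other-centre-reply : ∀ {P Q} → Sides P Q → path e ≡ P →
        ∃ λ c → path c ≡ Q × Centre c × s₁ c ≡ undir × ∃ λ o′ → Good (update s₁ c o′)
      other-centre-reply {Q = Q} sd refl with centres Q (side≢middle (swap-sides sd))
      ... | c , refl , mc = c , refl , mc
          , trans (off-path (sides-differ sd ∘ sym)) (open-at mc)
          , centre-reply mc (λ f p → trans
              (off-path (λ q → sides-differ sd (sym (trans (sym p) (trans (sym (path-mirror f)) q)))))
              (trans (symmetric f) (sym (off-path (λ q → sides-differ sd (trans (sym q) p)))))) g₁

      -- The two centres are the only edges without a partner, so after this exchange mirroring
      -- suffices for the rest of the game.
      centre-answer : Centre e → Reply Lost s₁
      centre-answer me with opposite-side (path e) (centre-side me)
      ... | Q , sd with other-centre-reply sd refl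
      ...   | c , pc , mc , uc , o′ , g₂ = reply c o′ uc g₂
              (paired (λ f → update-centre-symmetricOn o′ mc (update-centre-symmetricOn o me (λ f _ → symmetric f)) f refl)
                      none)
        where
        none : ∀ {f} → update s₁ c o′ f ≡ undir → ¬ Centre f
        none {f} uf mf with update-undirected s₁ o′ uf
        ... | f≢c , uf₁ with update-undirected s o uf₁
        ... | f≢e , _ with sides-cover sd (centre-side mf)
        ...   | inj₁ p = f≢e (centre-unique mf me p)
        ...   | inj₂ p = f≢c (centre-unique mf mc (trans p (sym pc)))

      LastPair : Set
      LastPair = ∀ f → path f ≡ path e → ¬ Centre f → f ≢ mirror e → s₁ f ≡ orient o

      -- If mirroring would leave no pair open, at most the centre stays open; then the directed
      -- edges of the path all run like `e`, which may threaten its cell.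
      other-pair? : ¬ Centre e → OpenPair (mirrored s e o) (path e) ⊎ LastPair
      other-pair? ne with OpenPair? (mirrored s e o) (path e)
      ... | yes pair = inj₁ pair
      ... | no none = inj₂ (last-pair-uniform e o symmetric (flow g₁) ne λ f p nf f≢e f≢me uf →
              none (f , p , nf , trans (mirrored-other s e o f≢e f≢me) uf))

      pair-persists : ∀ {X} → X ≢ path e → OpenPair s X → OpenPair (mirrored s e o) X
      pair-persists ne (f , p , nf , uf) =
        f , p , nf , trans (mirrored-off-path (ne ∘ trans (sym p))) uf

      has-persists : ∀ {X b} → Has s X b → Has (mirrored s e o) X b
      has-persists (f , p , sf) = f , p , mirrored-directed e o (λ f _ → symmetric f) u sf

      -- The waiting move on the other centre leaves just the mirror edge and the centre open on the
      -- path of `e`. Mirroring would leave only the centre, with the threat that the opponent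
      -- completes the cell by it.
      two-left-reply : path e ≢ middle → ¬ Centre e → LastPair →
        (∀ t → ¬ AtEnd t e) ⊎ Along s middle (not o) → Reply Lost s₁
      two-left-reply side ne last ends with opposite-side (path e) side | centres (path e) side
      ... | Q , sd | q , pq , mq with other-centre-reply sd refl
      ...   | c , pc , mc , uc , o′ , g₂ = reply c o′ uc g₂ (two-left {p = mirror e} {q} record
        { side       = side
        ; p≢q        = λ { refl → ne (mirror-injective mq) }
        ; p-on       = path-mirror e
        ; q-on       = pq
        ; p-open     = trans (off-Q (path-mirror e)) (mirror-free e o (λ f _ → symmetric f) ne u)
        ; q-open     = trans (off-Q pq) (trans (update-other s e o λ { refl → ne mq }) (open-at mq))
        ; rest       = λ f p f≢me f≢q → update-directed s₁ o′ uc
                         (last f p (λ mf → f≢q (centre-unique mf mq (trans p (sym pq)))) f≢me)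
        ; p-forced   = p-nbr
        ; q-forced   = q-nbr
        ; symmetric  = λ X ne → update-centre-symmetricOn o′ mc λ f p → trans
            (off-path (λ r → ne (trans (sym p) (trans (sym (path-mirror f)) r))))
            (trans (symmetric f) (sym (off-path (ne ∘ trans (sym p)))))
        ; no-centres = none
        ; ends       = ends′ ends
        })
        where
        s₂ = update s₁ c o′

        off-Q : ∀ {f} → path f ≡ path e → s₂ f ≡ s₁ f
        off-Q p = off-path λ r → sides-differ sd (trans (sym p) (trans r pc))

        p-nbr : ∃ λ y → Nbr (mirror e) y × s₂ y ≡ orient o
        p-nbr with non-centre-nbr (mirror e) (side ∘ trans (sym (path-mirror e)))
        ... | y , n , ny = y , n , update-directed s₁ o′ uc
              (last y (trans (nbr-path n) (path-mirror e)) ny λ { refl → nbr-irrefl n })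

        q-nbr : ∃ λ y → Nbr q y × s₂ y ≡ orient o
        q-nbr with non-centre-nbr q (side ∘ trans (sym pq))
        ... | y , n , ny with y ≟E mirror e
        ...   | no y≢ = y , n , update-directed s₁ o′ uc (last y (trans (nbr-path n) pq) ny y≢)
        -- The neighbour found is the open mirror edge, so `e` on the other side of the centre takes
        -- its place.
        ...   | yes refl = e , subst (λ x → Nbr x e) mq
                  (subst (Nbr (mirror q)) (mirror-involutive e) (nbr-mirror n))
              , update-directed s₁ o′ uc (update-same s e o)

        none : ∀ {f} → path f ≢ path e → s₂ f ≡ undir → ¬ Centre f
        none pf uf mf with sides-cover sd (centre-side mf)
        ... | inj₁ p = pf p
        ... | inj₂ p = proj₁ (update-undirected s₁ o′ uf) (centre-unique mf mc (trans p (sym pc)))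

        ends′ : (∀ t → ¬ AtEnd t e) ⊎ Along s middle (not o) →
                (∀ t → ¬ AtEnd t (mirror e) × ¬ AtEnd t q) ⊎ Along s₂ middle (not o)
        ends′ (inj₁ inner) = inj₁ λ t →
          (λ at → inner (flip t) (subst (AtEnd (flip t)) (mirror-involutive e) (mirror-AtEnd t at)))
          , centre-inner mq t
        ends′ (inj₂ al) = inj₂ λ f p → update-directed s₁ o′ uc (update-directed s o u (al f p))

      -- A middle edge along `d` spoils both cells at once, since both outer paths already have
      -- edges along `d`. As the middle path is open, its other edge cannot clash, and legality
      -- depends on the end `t` alone.
      dead-reply : ∀ {P Q d} t → Sides P Q → MiddleOpen s₁ →
        (∀ {x} b → path x ≡ middle → AtEnd t x → ¬ Saturated (update s₁ x d) t b) →
        (∀ t {e f} → path e ≡ P → AtEnd t e → Nbr e f → s₁ f ≡ orient d) →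
        Has s₁ Q d → Reply Lost s₁
      dead-reply {d = d} t sd mo unsat near (f , pf , sf) with end-edge t middle
      ... | x , px , at = reply x d ux
          (good (flow-fill x d (flow g₁) λ f n p → orient≢undir (trans (sym p) (mo f (trans (nbr-path n) px)))) ok)
          (dead (record
            { sides     = sd
            ; middle-d  = x , px , update-same s₁ x d
            ; near-ends = λ t p at n → update-directed s₁ d ux (near t p at n)
            ; side-d    = f , pf , update-directed s₁ d ux sf
            }))
        where
        ux = mo x px
        ok : ∀ v b → ¬ Saturated (update s₁ x d) v b
        ok v b sat with end-dichotomy t v
        ... | inj₁ refl = unsat b px at sat
        ... | inj₂ refl = unsaturated g₁ (flip t) b λ f p →
              trans (sym (update-other s₁ x d λ { refl → not-both-ends t at p })) (sat f p)

      middle-still-open : path e ≢ middle → MiddleOpen s → MiddleOpen s₁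
      middle-still-open ne mo f p = trans (off-path (ne ∘ λ q → trans (sym q) p)) (mo f p)

      -- If the other outer path has an edge in the direction of `e`, a middle edge in that
      -- direction spoils both cells. It is placed at the end of the mirror edge, which is open and
      -- so prevents saturation. Otherwise mirroring is safe and leads to `side-full`.
      end-answer : ∀ t → path e ≢ middle → ¬ Centre e → AtEnd t e → MiddleOpen s → LastPair → Answer s e o
      end-answer t side ne at mo last with opposite-side (path e) side
      ... | Q , sd with Has? s Q o
      ...   | no none = mirror-answer symmetric ne (side-full o sd (mirrored-balanced bal ne)
              (λ f p → trans (mirrored-off-path λ q → side (trans (sym q) p)) (mo f p))
              nearly
              λ { (f , p , sf) → none (f , p , trans (sym (mirrored-off-path λ q →
                    sides-differ sd (trans (sym q) p))) sf) })
        where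
        nearly : NearlyAlong (mirrored s e o) (path e) o
        nearly f p nf with f ≟E mirror e
        ... | yes refl = update-same s₁ (mirror e) o
        ... | no f≢ = trans (update-other s₁ (mirror e) o f≢) (last f p nf f≢)
      ...   | yes (f , p , sf) =
          no-cycle-beside e o nc (path-mirror e) free
        , dead-reply (flip t) sd (middle-still-open side mo)
            (λ {x} b px _ sat → orient≢undir (trans (sym (sat (mirror e) (mirror-AtEnd t at)))
              (trans (off-path λ q → side (trans (sym (path-mirror e)) (trans q px))) free)))
            (λ t′ {e′} {f′} p′ at′ n → last f′ (trans (nbr-path n) p′)
              (near-end-not-centre t′ (side ∘ trans (sym p′)) at′ n)
              λ { refl → near-end-inner t′ (side ∘ trans (sym p′)) at′ n (flip t) (mirror-AtEnd t at) })
            (f , p , update-directed s o u sf)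
        where
        free = mirror-free e o (λ f _ → symmetric f) ne u

      middle-open-answer : MiddleOpen s → (∀ X → X ≢ middle → OpenPair s X) → Answer s e o
      middle-open-answer mo pairs with mirror e ≟E e
      ... | yes me = no-cycle-middle refl (middle-still-open (centre-side me) mo middle-edge refl) , centre-answer me
      ... | no ne with path e ≟P middle
      ...   | yes pe = mirror-answer symmetric ne (middle-closed o (mirrored-balanced bal ne) along
                λ X X≢ → inj₁ (pair-persists (λ q → X≢ (trans q pe)) (pairs X X≢)))
        where
        along : Along (mirrored s e o) middle o
        along f p with middle-pair e f pe p
        ... | inj₁ refl = mirrored-same s e o
        ... | inj₂ refl = update-same s₁ (mirror e) o
      ...   | no side with other-pair? ne
      ...     | inj₁ pair = mirror-answer symmetric ne (middle-open (mirrored-balanced bal ne)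
                  (λ f p → trans (mirrored-off-path λ q → side (trans (sym q) p)) (mo f p)) pairs′)
        where
        pairs′ : ∀ X → X ≢ middle → OpenPair (mirrored s e o) X
        pairs′ X X≢ with X ≟P path e
        ... | yes refl = pair
        ... | no X≢e = pair-persists X≢e (pairs X X≢)
      ...     | inj₂ last with AtEnd? left e | AtEnd? right e
      ...       | yes at | _      = end-answer left side ne at mo last
      ...       | no _   | yes at = end-answer right side ne at mo last
      ...       | no nl  | no nr  =
            no-cycle-middle refl (middle-still-open side mo middle-edge refl)
          , two-left-reply side ne last (inj₁ λ { left → nl ; right → nr })

      middle-closed-answer : ∀ μ → Along s middle μ → (∀ X → X ≢ middle → OpenPair s X ⊎ Has s X μ) → Answer s e o
      middle-closed-answer μ al safe with path e ≟P middle
      ... | yes pe = ⊥-elim (orient≢undir (trans (sym (al e pe)) u))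
      ... | no side with mirror e ≟E e
      ...   | yes me = no-cycle-through e o nc blocked , centre-answer me
        where
        blocked : ∀ X b → X ≢ middle → path e ≡ X ⊎ path e ≡ middle → ¬ Cyclic s₁ X b
        blocked X b X≢ _ cyc with safe X X≢
        ... | inj₁ (f , p , nf , uf) =
                open-edge⇒¬Cyclic (trans (update-other s e o λ { refl → nf me }) uf) (inj₁ p) cyc
        ... | inj₂ (f , p , sf) = not-¬
                (orient-injective (trans (sym (update-directed s o u sf)) (proj₁ cyc f p)))
                (orient-injective (trans (sym (update-directed s o u (al middle-edge refl))) (proj₂ cyc middle-edge refl)))
      ...   | no ne with other-pair? ne | bool-dichotomy μ o
      ...     | inj₁ pair | _ = mirror-answer symmetric ne (middle-closed μ (mirrored-balanced bal ne)
                  (λ f p → mirrored-directed e o (λ f _ → symmetric f) u (al f p)) safe′)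
        where
        safe′ : ∀ X → X ≢ middle → OpenPair (mirrored s e o) X ⊎ Has (mirrored s e o) X μ
        safe′ X X≢ with X ≟P path e
        ... | yes refl = inj₁ pair
        ... | no X≢e = Sum.map (pair-persists X≢e) has-persists (safe X X≢)
      -- An outer path with an edge directed like the middle path can never close its cell, so it
      -- may be filled up.
      ...     | inj₂ last | inj₁ refl = mirror-answer symmetric ne (middle-closed μ (mirrored-balanced bal ne)
                  (λ f p → mirrored-directed e o (λ f _ → symmetric f) u (al f p)) safe′)
        where
        safe′ : ∀ X → X ≢ middle → OpenPair (mirrored s e o) X ⊎ Has (mirrored s e o) X μ
        safe′ X X≢ with X ≟P path e
        ... | yes refl = inj₂ (e , refl , mirrored-same s e o)
        ... | no X≢e = Sum.map (pair-persists X≢e) has-persists (safe X X≢)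
      -- Mirroring would leave the cell with only its centre open. The waiting move is safe even for
      -- an end edge: at both ends the middle edge opposes the direction `o`.
      ...     | inj₂ last | inj₂ refl =
            no-cycle-beside e o nc (path-mirror e) (mirror-free e o (λ f _ → symmetric f) ne u)
          , two-left-reply side ne last (inj₂ λ f p → trans (al f p) (cong orient (sym (not-involutive μ))))

      -- That `Q` has no edge along `d` keeps two special replies legal: its centre can be directed
      -- against `d`, and a middle edge along `d` can be played at an end where the edge of `Q` is
      -- not along `d`.
      module SideFull {P Q : Path} {d : Bool} (sd : Sides P Q) (mo : MiddleOpen s) (nearly : NearlyAlong s P d)
                      (none : ¬ Has s Q d) where
        P≢M = side≢middle sd
        Q≢M = side≢middle (swap-sides sd)

        end-of-P : ∃ λ f → path f ≡ P × s f ≡ orient d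
        end-of-P = let f , p , at = end-edge left P in f , p , nearly f p (end-not-centre left at)

        middle-answer : path e ≡ middle → Answer s e o
        middle-answer pe with bool-dichotomy d o | centres P P≢M | centres Q Q≢M
        -- The cell of `P` now lacks its centre and one middle edge. The centre of `Q` is the
        -- waiting move, and its direction against `d` spoils the cell of `Q`.
        ... | inj₂ refl | c , pc , mc | c′ , pc′ , mc′ =
            no-cycle-beside e o nc (path-mirror e) free
          , reply c′ o uc′ (good-inner c′ o g₁ (centre-inner mc′) (flow-fill c′ o (flow g₁) λ f n p →
              none (f , trans (nbr-path n) pc′ , trans (sym (off-M (trans (nbr-path n) pc′) Q≢M))
                (trans p (cong orient (not-involutive d))))))
              (one-left {c = c} {e} record
                { sides      = sd
                ; c-on       = pc
                ; c-centre   = mc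
                ; c-open     = trans (off-path λ q → sides-differ sd (trans (sym pc) (trans q pc′)))
                                 (trans (off-M pc P≢M) (open-at mc))
                ; nearly     = λ f p nf → update-directed s₁ o uc′ (update-directed s o u (nearly f p nf))
                ; m-on       = pe
                ; m-directed = update-directed s₁ o uc′ (update-same s e o)
                ; m′-open    = trans (off-path λ q → Q≢M (trans (sym pc′) (trans (sym q)
                                 (trans (path-mirror e) pe)))) free
                ; symmetric  = update-centre-symmetricOn o mc′ λ f p → trans
                    (off-M (trans (path-mirror f) p) Q≢M) (trans (symmetric f) (sym (off-M p Q≢M)))
                ; no-centres = λ p uf mf → proj₁ (update-undirected s₁ o uf)
                                 (centre-unique mf mc′ (trans p (sym pc′)))
                ; spoiled    = c′ , pc′ , update-same s₁ c′ o
                })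
          where
          off-M : ∀ {f X} → path f ≡ X → X ≢ middle → s₁ f ≡ s f
          off-M p X≢ = off-path λ q → X≢ (trans (sym p) (trans q pe))
          free = mirror-free e o (λ f _ → symmetric f) (middle-no-centre pe) u
          uc′ : s₁ c′ ≡ undir
          uc′ = trans (off-M pc′ Q≢M) (open-at mc′)
        ... | inj₁ refl | c , pc , mc | c′ , pc′ , mc′ with OpenPair? s Q
        ...   | yes pair = mirror-answer symmetric (middle-no-centre pe)
                  (middle-closed o (mirrored-balanced bal (middle-no-centre pe)) along safe)
          where
          along : Along (mirrored s e o) middle o
          along f p with middle-pair e f pe p
          ... | inj₁ refl = mirrored-same s e o
          ... | inj₂ refl = update-same s₁ (mirror e) o
          safe : ∀ X → X ≢ middle → OpenPair (mirrored s e o) X ⊎ Has (mirrored s e o) X o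
          safe X X≢ with sides-cover sd X≢
          ... | inj₁ refl = inj₂ (has-persists end-of-P)
          ... | inj₂ refl = inj₁ (pair-persists (λ q → X≢ (trans q pe)) pair)
        -- All edges of `Q` but its centre are against `d`, so mirroring would let the opponent
        -- close the cell of `Q` with that centre. The sides exchange roles, and the centre of `P`
        -- is the waiting move.
        ...   | no nopair =
            no-cycle-beside e o nc (path-mirror e) free
          , reply c o uc (good-inner c o g₁ (centre-inner mc) (flow-fill c o (flow g₁) λ f n →
              not-opposite (update-directed s o u (nearly f (trans (nbr-path n) pc) λ mf →
                nbr-irrefl (subst (Nbr c) (centre-unique mf mc (nbr-path n)) n)))))
              (one-left {d = not o} {c′} {e} record
                { sides      = swap-sides sd
                ; c-on       = pc′
                ; c-centre   = mc′
                ; c-open     = trans (off-path λ q → sides-differ sd (trans (sym pc) (trans (sym q) pc′)))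
                                 (trans (off-M pc′ Q≢M) (open-at mc′))
                ; nearly     = λ f p nf → update-directed s₁ o uc (update-directed s o u (against f p nf))
                ; m-on       = pe
                ; m-directed = update-directed s₁ o uc (trans (update-same s e o) o≡)
                ; m′-open    = trans (off-path λ q → P≢M (trans (sym pc) (trans (sym q)
                                 (trans (path-mirror e) pe)))) free
                ; symmetric  = update-centre-symmetricOn o mc λ f p → trans
                    (off-M (trans (path-mirror f) p) P≢M) (trans (symmetric f) (sym (off-M p P≢M)))
                ; no-centres = λ p uf mf → proj₁ (update-undirected s₁ o uf)
                                 (centre-unique mf mc (trans p (sym pc)))
                ; spoiled    = c , pc , trans (update-same s₁ c o) o≡
                })
          where
          o≡ : orient o ≡ orient (not (not o))
          o≡ = cong orient (sym (not-involutive o))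
          off-M : ∀ {f X} → path f ≡ X → X ≢ middle → s₁ f ≡ s f
          off-M p X≢ = off-path λ q → X≢ (trans (sym p) (trans q pe))
          free = mirror-free e o (λ f _ → symmetric f) (middle-no-centre pe) u
          uc : s₁ c ≡ undir
          uc = trans (off-M pc P≢M) (open-at mc)
          against : NearlyAlong s Q (not o)
          against f p nf with undirected-or-directed (s f)
          ... | inj₁ uf = ⊥-elim (nopair (f , p , nf , uf))
          ... | inj₂ (b , sf) with bool-dichotomy o b
          ...   | inj₁ refl = ⊥-elim (none (f , p , sf))
          ...   | inj₂ refl = sf

        -- The end `t` is chosen away from `e`: there the edge of `P` is along `d` and that of `Q`
        -- is not, so the middle edge saturates nothing.
        kill : path e ≡ Q → o ≡ d → ∀ t → ¬ AtEnd t e → Reply Lost s₁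
        kill pe refl t ne = dead-reply t sd (middle-still-open (Q≢M ∘ trans (sym pe)) mo) unsat
          (λ t p at n → update-directed s o u (nearly _ (trans (nbr-path n) p)
            (near-end-not-centre t (P≢M ∘ trans (sym p)) at n)))
          (e , pe , update-same s e o)
          where
          unsat : ∀ {x} b → path x ≡ middle → AtEnd t x → ¬ Saturated (update s₁ x o) t b
          unsat {x} b px _ sat with end-edge t P | end-edge t Q
          ... | f , pf , atf | f′ , pf′ , atf′ = none (f′ , pf′ ,
              trans (sym (trans (off-path λ q → Q≢M (trans (sym pf′) (trans q px)))
                                (update-other s e o λ { refl → ne atf′ })))
                (trans (sat f′ atf′) (trans (sym (sat f atf))
                  (trans (off-path λ q → P≢M (trans (sym pf) (trans q px)))
                         (update-directed s o u (nearly f pf (end-not-centre t atf)))))))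

        side-answer : path e ≡ Q → ¬ Centre e → Answer s e o
        side-answer pe ne with bool-dichotomy d o
        ... | inj₁ refl = no-cycle-beside e o nc (path-mirror e) (mirror-free e o (λ f _ → symmetric f) ne u) , move
          where
          move : Reply Lost s₁
          move with AtEnd? left e
          ... | yes at = kill pe refl right (not-both-ends left at)
          ... | no nl  = kill pe refl left nl
        ... | inj₂ refl = mirror-answer symmetric ne (side-full d sd (mirrored-balanced bal ne)
              (λ f p → trans (mirrored-off-path λ q → Q≢M (trans (sym pe) (trans (sym q) p))) (mo f p))
              (λ f p nf → mirrored-directed e o (λ f _ → symmetric f) u (nearly f p nf)) none′)
          where
          none′ : ¬ Has (mirrored s e o) Q d
          none′ (f , p , sf) with f ≟E e
          ... | yes refl = not-opposite sf (mirrored-same s e o)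
          ... | no f≢ with f ≟E mirror e
          ...   | yes refl = not-opposite sf (update-same s₁ (mirror e) o)
          ...   | no f≢′ = none (f , p , trans (sym (mirrored-other s e o f≢ f≢′)) sf)

        side-full-answer : Answer s e o
        side-full-answer with mirror e ≟E e
        ... | yes me = no-cycle-middle refl (middle-still-open (centre-side me) mo middle-edge refl) , centre-answer me
        ... | no ne with locate sd (path e)
        ...   | on-P p = ⊥-elim (orient≢undir (trans (sym (nearly e p ne)) u))
        ...   | on-M p = middle-answer p
        ...   | on-Q p = side-answer p ne

    -- A neighbour along `d` forces the direction of `e`, and the other open edge then fills the
    -- path. If the middle path is against `d`, this completes the cell; otherwise mirroring can go
    -- on, as the position is symmetric and has no open centre.
    two-left-pair : ∀ {P d q} → TwoLeft P d e q s → Answer s e o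
    two-left-pair {P} {d} {q} tl with TwoLeft.p-forced tl
    ... | y , n , sy with flow-agree (flow g₁) n (update-same s e o) (update-directed s o u sy)
    ...   | refl = no-cycle-beside e o nc (trans q-on (sym p-on)) q-free
        , reply q o q-free (good-balanced q o g₁ (flow-fill q o (flow g₁) near) (symmetric⇒balanced symmetric₂))
            (paired symmetric₂ none)
      where
      open TwoLeft tl
      q-free : s₁ q ≡ undir
      q-free = trans (update-other s e o (p≢q ∘ sym)) q-open
      s₂ = update s₁ q o
      full : ∀ f → path f ≡ P → s₂ f ≡ orient o
      full f p with f ≟E q
      ... | yes refl = update-same s₁ q o
      ... | no f≢q with f ≟E e
      ...   | yes refl = update-directed s₁ o q-free (update-same s e o)
      ...   | no f≢e = update-directed s₁ o q-free (update-directed s o u (rest f p f≢e f≢q))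
      near : ∀ f → Nbr q f → s₁ f ≢ orient (not o)
      near f n = not-opposite (trans (sym (update-other s₁ q o λ { refl → nbr-irrefl n }))
                                     (full f (trans (nbr-path n) q-on)))
      off : ∀ {f} → path f ≢ P → s₂ f ≡ s f
      off ne = trans (off-path (ne ∘ λ r → trans r q-on)) (off-path (ne ∘ λ r → trans r p-on))
      symmetric₂ : Symmetric s₂
      symmetric₂ f with path f ≟P P
      ... | yes p = trans (full (mirror f) (trans (path-mirror f) p)) (sym (full f p))
      ... | no ne = trans (off (ne ∘ trans (sym (path-mirror f)))) (trans (symmetric (path f) ne f refl) (sym (off ne)))
      none : ∀ {f} → s₂ f ≡ undir → ¬ Centre f
      none {f} uf with path f ≟P P
      ... | yes p = ⊥-elim (orient≢undir (trans (sym (full f p)) uf))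
      ... | no ne = no-centres ne (trans (sym (off ne)) uf)

    -- Saturation is the delicate point, since `P` itself is not symmetric. If `p` and `q` are
    -- inner, both end edges of `P` are along `d` and hence symmetric; otherwise the middle edge at
    -- each end is against `d`.
    two-left-mirror : ∀ {P d p q} → TwoLeft P d p q s → path e ≢ P → Answer s e o
    two-left-mirror {P} {d} {p} {q} tl side =
        no-cycle-beside e o nc (path-mirror e) free
      , reply (mirror e) o free g₂ (two-left {p = p} {q} record
          { side       = TwoLeft.side tl
          ; p≢q        = p≢q
          ; p-on       = p-on
          ; q-on       = q-on
          ; p-open     = trans (off p-on) p-open
          ; q-open     = trans (off q-on) q-open
          ; rest       = rest₂
          ; p-forced   = let y , n , sy = p-forced in y , n , directed sy
          ; q-forced   = let y , n , sy = q-forced in y , n , directed sy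
          ; symmetric  = λ X ne → mirrored-symmetricOn e o (symmetric X ne)
          ; no-centres = λ ne uf → no-centres ne (proj₂ (proj₂ (mirrored-undirected e o uf)))
          ; ends       = Sum.map₂ (λ al f p → directed (al f p)) ends
          })
      where
      open TwoLeft tl hiding (side)
      sym-e = symmetric (path e) side
      free = mirror-free e o sym-e (no-centres side u) u
      s₂ = mirrored s e o
      off : ∀ {f} → path f ≡ P → s₂ f ≡ s f
      off p = mirrored-off-path λ r → side (trans (sym r) p)
      directed : ∀ {f b} → s f ≡ orient b → s₂ f ≡ orient b
      directed = mirrored-directed e o sym-e u
      rest₂ : ∀ f → path f ≡ P → f ≢ p → f ≢ q → s₂ f ≡ orient d
      rest₂ f r f≢p f≢q = directed (rest f r f≢p f≢q)
      fl₂ = mirrored-flow e o sym-e (flow g₁)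
      g₂ : Good s₂
      g₂ with ends
      ... | inj₁ inner = good-balanced (mirror e) o g₁ fl₂ balanced
        where
        at-end : ∀ t {f} → path f ≡ P → AtEnd t f → s₂ f ≡ orient d
        at-end t r at = rest₂ _ r (λ { refl → proj₁ (inner t) at }) (λ { refl → proj₂ (inner t) at })
        balanced : ∀ t b → Saturated s₂ t b → Saturated s₂ (flip t) b
        balanced t b sat f at with path f ≟P P
        ... | no ne = trans (sym (mirrored-symmetricOn e o (symmetric (path f) ne) f refl))
                        (sat (mirror f) (unmirror-AtEnd t at))
        ... | yes r = trans (at-end (flip t) r at)
                        (trans (sym (at-end t (trans (path-mirror f) r) (unmirror-AtEnd t at)))
                               (sat (mirror f) (unmirror-AtEnd t at)))
      ... | inj₂ al = good fl₂ unsat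
        where
        unsat : ∀ t b → ¬ Saturated s₂ t b
        unsat t b sat with end-edge t P | end-edge t middle
        ... | f , pf , atf | f′ , pf′ , atf′ with orient-injective
              (trans (sym (rest f pf (open≢ p-open) (open≢ q-open))) (trans (sym (off pf)) (sat f atf)))
          where
          open≢ : ∀ {x} → s x ≡ undir → f ≢ x
          open≢ ux refl = orient≢undir (trans (sym (sat f atf)) (trans (off pf) ux))
        ...   | refl = not-opposite (sat f′ atf′) (directed (al f′ pf′))

    two-left-swap : ∀ {P d p q} → TwoLeft P d p q s → TwoLeft P d q p s
    two-left-swap tl = record
      { side = side ; p≢q = p≢q ∘ sym ; p-on = q-on ; q-on = p-on ; p-open = q-open ; q-open = p-open
      ; rest = λ f r f≢q f≢p → rest f r f≢p f≢q
      ; p-forced = q-forced ; q-forced = p-forced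
      ; symmetric = symmetric ; no-centres = no-centres
      ; ends = Sum.map₁ (λ inner t → proj₂ (inner t) , proj₁ (inner t)) ends
      }
      where open TwoLeft tl

    two-left-answer : ∀ {P d p q} → TwoLeft P d p q s → Answer s e o
    two-left-answer {P} {p = p} {q} tl with path e ≟P P
    ... | no side = two-left-mirror tl side
    ... | yes pe with e ≟E p
    ...   | yes refl = two-left-pair tl
    ...   | no e≢p with e ≟E q
    ...     | yes refl = two-left-pair (two-left-swap tl)
    ...     | no e≢q = ⊥-elim (orient≢undir (trans (sym (TwoLeft.rest tl e pe e≢p e≢q)) u))

    module _ {P Q : Path} {d : Bool} {c m : Edge} (ol : OneLeft P Q d c m s) where
      open OneLeft ol

      private
        P≢M = side≢middle sides
        Q≢M = side≢middle (swap-sides sides)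

        -- At each end `P` contributes an edge along `d`, and the middle path one that is undirected
        -- or against `d`.
        split-ends : ∀ {s₂} → (∀ {f b} → s f ≡ orient b → s₂ f ≡ orient b) →
          (s₂ (mirror m) ≡ undir ⊎ s₂ (mirror m) ≡ orient (not d)) → ∀ t b → ¬ Saturated s₂ t b
        split-ends {s₂} keep m′ t b sat with end-edge t P | end-edge t middle
        ... | f , pf , atf | f′ , pf′ , atf′ with orient-injective
              (trans (sym (keep (nearly f pf (end-not-centre t atf)))) (sat f atf))
        ...   | refl with middle-pair m f′ m-on pf′
        ...     | inj₁ refl = not-opposite (sat f′ atf′) (keep m-directed)
        ...     | inj₂ refl with m′
        ...       | inj₁ u′ = orient≢undir (trans (sym (sat f′ atf′)) u′)
        ...       | inj₂ d′ = not-opposite (sat f′ atf′) d′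

        -- In `s₂` the cell of `P` is complete and the responder has won. As `Reply` asks for an
        -- invariant in every case, `paired` provides it.
        finished : ∀ {s₂} → (∀ {f b} → s f ≡ orient b → s₂ f ≡ orient b) → (∀ {f} → path f ≡ Q → s₂ f ≡ s f) →
          s₂ c ≡ orient d → s₂ (mirror m) ≡ orient (not d) → Lost s₂
        finished {s₂} keep on-Q≡ sc sm′ = paired sym₂ none
          where
          on-P≡ : ∀ f → path f ≡ P → s₂ f ≡ orient d
          on-P≡ f p with mirror f ≟E f
          ... | yes mf = trans (cong s₂ (centre-unique mf c-centre (trans p (sym c-on)))) sc
          ... | no nf = keep (nearly f p nf)
          on-M≡ : ∀ f → path f ≡ middle → s₂ f ≡ orient (not d)
          on-M≡ f p with middle-pair m f m-on p
          ... | inj₁ refl = keep m-directed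
          ... | inj₂ refl = sm′
          sym₂ : Symmetric s₂
          sym₂ f with locate sides (path f)
          ... | on-P p = trans (on-P≡ _ (trans (path-mirror f) p)) (sym (on-P≡ f p))
          ... | on-M p = trans (on-M≡ _ (trans (path-mirror f) p)) (sym (on-M≡ f p))
          ... | on-Q p = trans (on-Q≡ (trans (path-mirror f) p)) (trans (symmetric f p) (sym (on-Q≡ p)))
          none : ∀ {f} → s₂ f ≡ undir → ¬ Centre f
          none {f} uf with locate sides (path f)
          ... | on-P p = ⊥-elim (orient≢undir (trans (sym (on-P≡ f p)) uf))
          ... | on-M p = ⊥-elim (orient≢undir (trans (sym (on-M≡ f p)) uf))
          ... | on-Q p = no-centres p (trans (sym (on-Q≡ p)) uf)

        m′-on : path (mirror m) ≡ middle
        m′-on = trans (path-mirror m) m-on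

        directed₁ : ∀ {f b} → s f ≡ orient b → s₁ f ≡ orient b
        directed₁ = update-directed s o u

      one-left-centre : e ≡ c → Answer s e o
      one-left-centre refl with non-centre-nbr c (P≢M ∘ trans (sym c-on))
      ... | y , n , ny with flow-agree (flow g₁) n (update-same s e o)
                              (directed₁ (nearly y (trans (nbr-path n) c-on) ny))
      ...   | refl = no-cycle-middle m′-on free
          , reply (mirror m) (not o) free
              (good (flow-fill (mirror m) (not o) (flow g₁) near)
                    (split-ends (update-directed s₁ (not o) free ∘ directed₁) (inj₂ (update-same s₁ (mirror m) (not d)))))
              (finished (update-directed s₁ (not o) free ∘ directed₁)
                (λ p → trans (off-path λ r → Q≢M (trans (sym p) (trans r m′-on)))
                             (off-path λ r → sides-differ sides (sym (trans (sym p) (trans r c-on)))))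
                (update-directed s₁ (not o) free (update-same s e o)) (update-same s₁ (mirror m) (not d)))
        where
        free : s₁ (mirror m) ≡ undir
        free = trans (off-path λ r → P≢M (trans (sym c-on) (trans (sym r) m′-on))) m′-open
        near : ∀ f → Nbr (mirror m) f → s₁ f ≢ orient (not (not o))
        near f n with middle-pair m f m-on (trans (nbr-path n) m′-on)
        ... | inj₁ refl = not-opposite (directed₁ m-directed)
        ... | inj₂ refl = ⊥-elim (nbr-irrefl n)

      -- The second middle edge does not win for the opponent: the cell of `P` still lacks its
      -- centre, and `spoiled` blocks that of `Q`.
      one-left-middle : e ≡ mirror m → Answer s e o
      one-left-middle refl with flow-agree (flow g₁) (middle-nbr m m-on) (update-same s e o) (directed₁ m-directed)
      ... | refl = no-cycle-through e o nc blocked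
          , reply c d free
              (good-inner c d g₁ (centre-inner c-centre) (flow-fill c d (flow g₁) λ f n →
                not-opposite (directed₁ (nearly f (trans (nbr-path n) c-on) λ mf →
                  nbr-irrefl (subst (Nbr c) (centre-unique mf c-centre (nbr-path n)) n)))))
              (finished (update-directed s₁ d free ∘ directed₁)
                (λ p → trans (off-path λ r → sides-differ sides (sym (trans (sym p) (trans r c-on))))
                             (off-path λ r → Q≢M (trans (sym p) (trans r m′-on))))
                (update-same s₁ c d) (update-directed s₁ d free (update-same s e o)))
        where
        free : s₁ c ≡ undir
        free = trans (off-path λ r → P≢M (trans (sym c-on) (trans r m′-on))) c-open
        blocked : ∀ X b → X ≢ middle → path e ≡ X ⊎ path e ≡ middle → ¬ Cyclic s₁ X b
        blocked X b X≢ _ cyc with sides-cover sides X≢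
        ... | inj₁ refl = open-edge⇒¬Cyclic free (inj₁ c-on) cyc
        ... | inj₂ refl = let f , p , sf = spoiled in not-¬
              (orient-injective (trans (sym (directed₁ sf)) (proj₁ cyc f p)))
              (orient-injective (trans (sym (directed₁ m-directed)) (proj₂ cyc m m-on)))

      one-left-side : path e ≡ Q → Answer s e o
      one-left-side refl =
          no-cycle-beside e o nc (path-mirror e) free
        , reply (mirror e) o free
            (good (mirrored-flow e o symmetric (flow g₁))
                  (split-ends keep (inj₁ m′₂)))
            (one-left {c = c} {m} record
              { sides      = sides
              ; c-on       = c-on
              ; c-centre   = c-centre
              ; c-open     = trans (mirrored-off-path λ r → sides-differ sides (trans (sym c-on) r)) c-open
              ; nearly     = λ f p nf → keep (nearly f p nf)
              ; m-on       = m-on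
              ; m-directed = keep m-directed
              ; m′-open    = m′₂
              ; symmetric  = mirrored-symmetricOn e o symmetric
              ; no-centres = λ p uf → no-centres p (proj₂ (proj₂ (mirrored-undirected e o uf)))
              ; spoiled    = let f , p , sf = spoiled in f , p , keep sf
              })
        where
        free = mirror-free e o symmetric (no-centres refl u) u
        keep : ∀ {f b} → s f ≡ orient b → mirrored s e o f ≡ orient b
        keep = mirrored-directed e o symmetric u
        m′₂ : mirrored s e o (mirror m) ≡ undir
        m′₂ = trans (mirrored-off-path λ r → Q≢M (trans (sym r) m′-on)) m′-open

      one-left-answer : Answer s e o
      one-left-answer with locate sides (path e)
      ... | on-Q p = one-left-side p
      ... | on-M p with middle-pair m e m-on p
      ...   | inj₁ refl = ⊥-elim (orient≢undir (trans (sym m-directed) u))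
      ...   | inj₂ eq = one-left-middle eq
      one-left-answer | on-P p with mirror e ≟E e
      ...   | yes me = one-left-centre (centre-unique me c-centre (trans p (sym c-on)))
      ...   | no ne = ⊥-elim (orient≢undir (trans (sym (nearly e p ne)) u))

    dead-answer : ∀ {P Q d} → Dead P Q d s → odd (count s₁) ≡ true → Answer s e o
    dead-answer dd od with dead-update e o u dd
    ... | dd₁ with dead⇒move g₁ dd₁ od
    ...   | e′ , o′ , u′ , g₂ = dead⇒NoCycle dd₁ , reply e′ o′ u′ g₂ (dead (dead-update e′ o′ u′ dd₁))

  lost-responsive : Responsive Lost
  lost-responsive inv g nc e o u g₁ od = answer inv
    where
    open Turn g nc e o u g₁
    answer : Lost _ → Answer _ e o
    answer (paired sy none)              = paired-answer sy none
    answer (middle-open bal mo pairs)    = middle-open-answer bal mo pairs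
    answer (middle-closed μ bal al safe) = middle-closed-answer bal μ al safe
    answer (side-full d sd bal mo nearly none) = SideFull.side-full-answer bal sd mo nearly none
    answer (two-left tl)                 = two-left-answer tl
    answer (one-left ol)                 = one-left-answer ol
    answer (dead dd)                     = dead-answer dd od

  lost⇒Lose : ∀ {s} → Lost s → Good s → NoCycle s → odd (count s) ≡ false → Lose s
  lost⇒Lose = responsive⇒Lose lost-responsive _ (ℕ.n<1+n _)

-- Parity of the lengths and the initial position

odd⇒halves : ∀ n → odd n ≡ true → ∃ λ m → m + suc m ≡ n
odd⇒halves (suc zero) _ = 0 , refl
odd⇒halves (suc (suc n)) p with odd⇒halves n (trans (sym (not-involutive _)) p)
... | m , eq = suc m , cong suc (trans (ℕ.+-suc m (suc m)) (cong suc eq))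

halves-odd : ∀ m → odd (m + suc m) ≡ true
halves-odd zero    = refl
halves-odd (suc m) = trans (cong (not ∘ odd) (ℕ.+-suc m (suc m)))
                       (trans (not-involutive _) (halves-odd m))

%2≡0⇒even : ∀ n → n % 2 ≡ 0 → odd n ≡ false
%2≡0⇒even zero          _ = refl
%2≡0⇒even (suc (suc n)) p = trans (not-involutive _) (%2≡0⇒even n p)

%2≡1⇒odd : ∀ n → n % 2 ≡ 1 → odd n ≡ true
%2≡1⇒odd (suc zero)    _ = refl
%2≡1⇒odd (suc (suc n)) p = trans (not-involutive _) (%2≡1⇒odd n p)

module Opening (j k : ℕ) (4≤j : 4 ≤ j) (4≤k : 4 ≤ k) where
  open Strategy j k 4≤j 4≤k

  good-start : Good start
  good-start = good (λ b _ p _ → orient≢undir {b} (sym p))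
    λ t b sat → let e , _ , at = end-edge t upper in orient≢undir {b} (sym (sat e at))

  -- The responder needs an even count whenever the opponent is to move; the two middle edges cancel
  -- modulo 2.
  odd-start : odd (count start) ≡ odd j xor odd k
  odd-start = begin
    odd (count start)       ≡⟨ cong odd count-start ⟩
    odd (j + 2 + k)         ≡⟨ odd-+ (j + 2) k ⟩
    odd (j + 2) xor odd k   ≡⟨ cong (λ n → odd n xor odd k) (ℕ.+-comm j 2) ⟩
    not (not (odd j)) xor odd k ≡⟨ cong (_xor odd k) (not-involutive (odd j)) ⟩
    odd j xor odd k         ∎
    where open ≡-Reasoning

  -- In a path with `2m + 1` edges the edge of index `m` has `m` edges on either side.
  centre-of : ∀ X → odd (len X) ≡ true → ∃ λ c → path c ≡ X × Centre c
  centre-of X p with odd⇒halves (len X) p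
  ... | m , eq with edge-at X {m} (ℕ.<-≤-trans (ℕ.m<m+n m (s≤s z≤n)) (ℕ.≤-reflexive eq))
  ...   | c , pc , refl = c , pc , edge-unique (path-mirror c)
          (ℕ.+-cancelʳ-≡ (suc (idx c)) _ _ (trans (idx-mirror c) (trans (cong len pc) (sym eq))))

  even⇒no-centre : ∀ {e} → odd (len (path e)) ≡ false → ¬ Centre e
  even⇒no-centre {e} p c =
    case trans (sym p) (trans (cong odd (sym (centre-idx c))) (halves-odd (idx e))) of λ ()

  all-even⇒Lost : odd j ≡ false → odd k ≡ false → Lost start
  all-even⇒Lost p q = paired (λ _ → refl) λ {f} _ → even⇒no-centre {f} (even (path f))
    where
    even : ∀ X → odd (len X) ≡ false
    even upper  = p
    even middle = refl
    even lower  = q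

  sides-odd⇒Lost : odd j ≡ true → odd k ≡ true → Lost start
  sides-odd⇒Lost p q = middle-open
    (record { centres = centres ; symmetric = λ _ → refl ; open-at = λ _ → refl })
    (λ _ _ → refl)
    λ X _ → let e , pe , at = end-edge left X in e , pe , end-not-centre left at , refl
    where
    centres : ∀ X → X ≢ middle → ∃ λ c → path c ≡ X × Centre c
    centres upper  _  = centre-of upper p
    centres middle ne = ⊥-elim (ne refl)
    centres lower  _  = centre-of lower q

  even⇒Lose : odd j xor odd k ≡ false → Lose start
  even⇒Lose p = lost⇒Lose (lost (odd j) (odd k) refl refl p) good-start
      (no-cycle-middle {f = middle-edge} refl refl) (trans odd-start p)
    where
    lost : ∀ x y → odd j ≡ x → odd k ≡ y → x xor y ≡ false → Lost start
    lost true  true  p q _  = sides-odd⇒Lost p q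
    lost false false p q _  = all-even⇒Lost p q
    lost true  false _ _ ()
    lost false true  _ _ ()

  centre-first : ∀ {P Q} → Sides P Q → odd (len P) ≡ true → odd (len Q) ≡ false →
                 odd (count start) ≡ true → Win start
  centre-first {P} sd p q od with centre-of P p
  ... | c , pc , mc = win c true (refl , Good⇒NoSinkSource g₁) (inj₂ (lost⇒Lose lost g₁
      (no-cycle-middle {f = middle-edge} refl (update-other start c true λ { refl → middle-no-centre refl mc }))
      (trans (sym (not-involutive _)) (cong not (trans (cong odd (sym (count-update start c true refl))) od)))))
    where
    g₁ : Good (update start c true)
    g₁ = good-inner c true good-start (centre-inner mc) (flow-fill c true (flow good-start) λ _ _ ())
    lost : Lost (update start c true)
    lost = paired (λ f → update-centre-symmetricOn true mc (λ _ _ → refl) f refl) none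
      where
      none : ∀ {f} → update start c true f ≡ undir → ¬ Centre f
      none {f} u mf with sides-cover sd (centre-side mf)
      ... | inj₁ r    = proj₁ (update-undirected start true u) (centre-unique mf mc (trans r (sym pc)))
      ... | inj₂ refl = even⇒no-centre {f} q mf

  odd⇒Win : odd j xor odd k ≡ true → Win start
  odd⇒Win p = go (odd j) (odd k) refl refl p
    where
    go : ∀ x y → odd j ≡ x → odd k ≡ y → x xor y ≡ true → Win start
    go true  false p′ q′ _ = centre-first upper-lower p′ q′ (trans odd-start p)
    go false true  p′ q′ _ = centre-first lower-upper q′ p′ (trans odd-start p)
    go true  true  _ _ ()
    go false false _ _ ()

theorem2 : (j k : ℕ) → 4 ≤ j → 4 ≤ k →
    ((j + k) % 2 ≡ 1 → Game.Win (jk-board j k) (Game.start (jk-board j k)))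
    × ((j + k) % 2 ≡ 0 → Game.Lose (jk-board j k) (Game.start (jk-board j k)))
theorem2 j k 4≤j 4≤k =
    (λ p → odd⇒Win (trans (sym (odd-+ j k)) (%2≡1⇒odd (j + k) p)))
  , (λ p → even⇒Lose (trans (sym (odd-+ j k)) (%2≡0⇒even (j + k) p)))
  where open Opening j k 4≤j 4≤k
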